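{- Let $0<\alpha\le 1/2$ be a real number. For a real number $\beta$ with $0<\beta\le 1/2$, consider the following statements, each quantified over all digraphs $D$, where $n=|V(D)|$: \begin{itemize} \item $\mathrm{I}(\beta)$: for every sink-free digraph $D$, $D$ has a quasi-kernel of size at most $(1-\beta)n$. \item $\mathrm{II}(\beta)$: for every digraph $D$, $D$ has a quasi-kernel of size at most $n-\beta s$, where $s$ is the number of sources of $D$ that are not sinks of $D$. \item $\mathrm{III}(\beta)$: for every digraph $D$, $D$ has a quasi-kernel $Q$ such that $|N^-[Q]|\ge \beta n$. \end{itemize} Let $\mathrm{II}^{\mathrm{sf}}(\beta)$ and $\mathrm{III}^{\mathrm{sf}}(\beta)$ denote the sink-free versions, i.e. the statements obtained from $\mathrm{II}(\beta)$ and $\mathrm{III}(\beta)$ by restricting to sink-free digraphs $D$. Then: \begin{itemize} \item $\mathrm{II}(\alpha)$ and $\mathrm{III}(\alpha)$ are equivalent; moreover $\mathrm{II}(\alpha)$ is equivalent to $\mathrm{II}^{\mathrm{sf}}(\alpha)$, and $\mathrm{III}(\alpha)$ is equivalent to $\mathrm{III}^{\mathrm{sf}}(\alpha)$. \item $\mathrm{I}(\alpha)$ implies $\mathrm{III}(\alpha)$. \item $\mathrm{III}(\alpha)$ implies $\mathrm{I}\left(\frac{\alpha}{1+\alpha}\right)$. \end{itemize}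
   Context: Digraphs $D=(V(D),A(D))$ are finite, without loops or parallel arcs; a pair of opposite arcs $uv,vu$ (directed 2-cycle) is allowed. If $xy\in A(D)$, then $y$ is an out-neighbor of $x$ and $x$ is an in-neighbor of $y$. A sink is a vertex with no out-neighbors; a source is a vertex with no in-neighbors; a digraph is sink-free if it has no sinks. For vertices $u,v$, $\mathrm{dist}(u,v)\in\mathbb{Z}^{\ge 0}\cup\{\infty\}$ is the length of a shortest directed path from $u$ to $v$, and for $S\subseteq V(D)$, $\mathrm{dist}(u,S)=\min_{v\in S}\mathrm{dist}(u,v)$ (equal to $\infty$ if $S=\emptyset$). Define $N^-[S]=\{u\in V(D):\mathrm{dist}(u,S)\le 1\}$. A set of vertices is independent if there is no arc between any two of its vertices. A quasi-kernel of $D$ is an independent set $Q\subseteq V(D)$ such that $\mathrm{dist}(u,Q)\le 2$ for every $u\in V(D)$. -}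

module Defs where

open import Algebra.Bundles using (CommutativeMonoid)
open import Algebra.Properties.CommutativeSemigroup using (interchange)
open import Data.Fin using (Fin)
open import Data.Fin.Properties using (any?; all?) renaming (_≟_ to _≟F_)
open import Data.Fin.Subset using (Subset; _∈_; ∣_∣)
open import Data.Fin.Subset.Properties using (_∈?_)
import Data.Integer as ℤ
open import Data.Nat as ℕ using (ℕ; zero; suc)
import Data.Nat.Properties as ℕ
open import Data.Product using (∃; ∃-syntax; _×_; _,_)
open import Data.Rational as ℚ using (ℚ; 0ℚ; 1ℚ)
import Data.Rational.Properties as ℚ
open import Data.Vec using (Vec; []; _∷_; head; last; tabulate)
open import Data.Vec.Relation.Unary.AllPairs using (allPairs?)
open import Data.Vec.Relation.Unary.Linked using (Linked; linked?)
open import Data.Vec.Relation.Unary.Unique.Propositional using (Unique)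
open import Level using (0ℓ)
open import Relation.Binary using (Rel; Irreflexive)
  renaming (Decidable to Decidable₂)
open import Relation.Binary.PropositionalEquality
open import Relation.Nullary using (¬_; Dec; does; _×-dec_; ¬?)
open import Relation.Nullary.Decidable using (map′)
open import Relation.Unary using (Pred; Decidable)

------------------------------------------------------------------------
-- Real numbers

-- Cauchy sequences of rationals.  No equality of reals is needed below; the
-- order does not distinguish sequences whose difference tends to 0.

record ℝ : Set where
  constructor mkℝ
  field
    seq    : ℕ → ℚ
    cauchy : ∀ ε → 0ℚ ℚ.< ε → ∃[ N ] (∀ m n → N ℕ.≤ m → N ℕ.≤ n →
             ℚ.∣ seq m ℚ.- seq n ∣ ℚ.≤ ε)

open ℝ public

infix 4 _≤_ _<_

_≤_ : ℝ → ℝ → Set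
x ≤ y = ∀ ε → 0ℚ ℚ.< ε → ∃[ N ] (∀ n → N ℕ.≤ n → seq x n ℚ.≤ seq y n ℚ.+ ε)

_<_ : ℝ → ℝ → Set
x < y = ∃[ ε ] 0ℚ ℚ.< ε × ∃[ N ] (∀ n → N ℕ.≤ n → seq x n ℚ.+ ε ℚ.≤ seq y n)

fromℚ : ℚ → ℝ
seq    (fromℚ q) _ = q
cauchy (fromℚ q) ε 0<ε = 0 , λ _ _ _ _ →
  subst (ℚ._≤ ε) (cong ℚ.∣_∣ (sym (ℚ.+-inverseʳ q))) (ℚ.<⇒≤ 0<ε)

fromℕ : ℕ → ℝ
fromℕ n = fromℚ (ℤ.+ n ℚ./ 1)

0ℝ 1ℝ ½ℝ : ℝ
0ℝ = fromℚ 0ℚ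
1ℝ = fromℚ 1ℚ
½ℝ = fromℚ ℚ.½

half>0 : ∀ {ε} → 0ℚ ℚ.< ε → 0ℚ ℚ.< ε ℚ.* ℚ.½
half>0 {ε} 0<ε = ℚ.positive⁻¹ (ε ℚ.* ℚ.½)
  {{ℚ.pos*pos⇒pos ε {{ℚ.positive 0<ε}} ℚ.½}}

half+half : ∀ ε → ε ℚ.* ℚ.½ ℚ.+ ε ℚ.* ℚ.½ ≡ ε
half+half ε = trans (sym (ℚ.*-distribˡ-+ ε ℚ.½ ℚ.½)) (ℚ.*-identityʳ ε)

+-interchange : ∀ a b c d →
  (a ℚ.+ b) ℚ.- (c ℚ.+ d) ≡ (a ℚ.- c) ℚ.+ (b ℚ.- d)
+-interchange a b c d = trans
  (cong (a ℚ.+ b ℚ.+_) (ℚ.neg-distrib-+ c d))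
  (interchange
    (CommutativeMonoid.commutativeSemigroup ℚ.+-0-commutativeMonoid)
    a b (ℚ.- c) (ℚ.- d))

neg-minus : ∀ a b → (ℚ.- a) ℚ.- (ℚ.- b) ≡ ℚ.- (a ℚ.- b)
neg-minus a b = sym (ℚ.neg-distrib-+ a (ℚ.- b))

minus-plus : ∀ a b → a ≡ (a ℚ.- b) ℚ.+ b
minus-plus a b = sym (trans (ℚ.+-assoc a (ℚ.- b) b)
  (trans (cong (a ℚ.+_) (ℚ.+-inverseˡ b)) (ℚ.+-identityʳ a)))

telescope : ∀ p q r → p ℚ.- r ≡ (p ℚ.- q) ℚ.+ (q ℚ.- r)
telescope p q r = trans (cong (ℚ._- r) (minus-plus p q))
  (ℚ.+-assoc (p ℚ.- q) q (ℚ.- r))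

*-distribˡ-- : ∀ p q r → p ℚ.* q ℚ.- p ℚ.* r ≡ p ℚ.* (q ℚ.- r)
*-distribˡ-- p q r = trans
  (cong (p ℚ.* q ℚ.+_) (ℚ.neg-distribʳ-* p r))
  (sym (ℚ.*-distribˡ-+ p q (ℚ.- r)))

*-minus : ∀ a b c d →
  (a ℚ.* b) ℚ.- (c ℚ.* d) ≡ a ℚ.* (b ℚ.- d) ℚ.+ d ℚ.* (a ℚ.- c)
*-minus a b c d = trans (telescope (a ℚ.* b) (a ℚ.* d) (c ℚ.* d))
  (cong₂ ℚ._+_ (*-distribˡ-- a b d)
    (trans (cong₂ ℚ._-_ (ℚ.*-comm a d) (ℚ.*-comm c d)) (*-distribˡ-- d a c)))

*-mono-abs : ∀ {a b c d} → ℚ.∣ a ∣ ℚ.≤ c → ℚ.∣ b ∣ ℚ.≤ d →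
             ℚ.∣ a ℚ.* b ∣ ℚ.≤ c ℚ.* d
*-mono-abs {a} {b} {c} {d} a≤c b≤d = begin
  ℚ.∣ a ℚ.* b ∣        ≡⟨ ℚ.∣p*q∣≡∣p∣*∣q∣ a b ⟩
  ℚ.∣ a ∣ ℚ.* ℚ.∣ b ∣  ≤⟨ ℚ.*-monoʳ-≤-nonNeg ℚ.∣ b ∣ {{ℚ.∣-∣-nonNeg b}} a≤c ⟩
  c ℚ.* ℚ.∣ b ∣        ≤⟨ ℚ.*-monoˡ-≤-nonNeg c {{ℚ.nonNegative 0≤c}} b≤d ⟩
  c ℚ.* d              ∎
  where
  open ℚ.≤-Reasoning
  0≤c : 0ℚ ℚ.≤ c
  0≤c = ℚ.≤-trans (ℚ.0≤∣p∣ a) a≤c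

bounded : ∀ x → ∃[ K ] ℚ.Positive K ×
          ∃[ N ] (∀ n → N ℕ.≤ n → ℚ.∣ seq x n ∣ ℚ.≤ K)
bounded x with N , close ← cauchy x 1ℚ (ℚ.positive⁻¹ 1ℚ) =
  1ℚ ℚ.+ ℚ.∣ seq x N ∣
  , ℚ.pos+nonNeg⇒pos 1ℚ ℚ.∣ seq x N ∣ {{ℚ.∣-∣-nonNeg (seq x N)}}
  , N , λ n N≤n → begin
    ℚ.∣ seq x n ∣
      ≡⟨ cong ℚ.∣_∣ (minus-plus (seq x n) (seq x N)) ⟩
    ℚ.∣ (seq x n ℚ.- seq x N) ℚ.+ seq x N ∣
      ≤⟨ ℚ.∣p+q∣≤∣p∣+∣q∣ (seq x n ℚ.- seq x N) (seq x N) ⟩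
    ℚ.∣ seq x n ℚ.- seq x N ∣ ℚ.+ ℚ.∣ seq x N ∣
      ≤⟨ ℚ.+-monoˡ-≤ ℚ.∣ seq x N ∣ (close n N N≤n ℕ.≤-refl) ⟩
    1ℚ ℚ.+ ℚ.∣ seq x N ∣ ∎
  where open ℚ.≤-Reasoning

-- A positive rational η with K * η ≡ ε.
quotient : ∀ K ε → ℚ.Positive K → 0ℚ ℚ.< ε → ∃[ η ] 0ℚ ℚ.< η × K ℚ.* η ≡ ε
quotient K ε K>0 0<ε =
  1/K ℚ.* ε
  , ℚ.positive⁻¹ (1/K ℚ.* ε)
      {{ℚ.pos*pos⇒pos 1/K {{ℚ.1/pos⇒pos K {{K>0}}}} ε {{ℚ.positive 0<ε}}}}
  , (begin
      K ℚ.* (1/K ℚ.* ε)  ≡⟨ ℚ.*-assoc K 1/K ε ⟨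
      K ℚ.* 1/K ℚ.* ε    ≡⟨ cong (ℚ._* ε) (ℚ.*-inverseʳ K {{ℚ.pos⇒nonZero K {{K>0}}}}) ⟩
      1ℚ ℚ.* ε           ≡⟨ ℚ.*-identityˡ ε ⟩
      ε                  ∎)
  where
  open ≡-Reasoning
  1/K : ℚ
  1/K = (ℚ.1/ K) {{ℚ.pos⇒nonZero K {{K>0}}}}

infixl 6 _+_ _-_
infixl 7 _*_ _/_⟨_⟩
infix  8 -_

_+_ : ℝ → ℝ → ℝ
seq    (x + y) n = seq x n ℚ.+ seq y n
cauchy (x + y) ε 0<ε
  with M , xM ← cauchy x (ε ℚ.* ℚ.½) (half>0 0<ε)
     | N , yN ← cauchy y (ε ℚ.* ℚ.½) (half>0 0<ε) =
  M ℕ.⊔ N , λ m n M⊔N≤m M⊔N≤n → begin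
    ℚ.∣ (seq x m ℚ.+ seq y m) ℚ.- (seq x n ℚ.+ seq y n) ∣
      ≡⟨ cong ℚ.∣_∣ (+-interchange (seq x m) (seq y m) (seq x n) (seq y n)) ⟩
    ℚ.∣ (seq x m ℚ.- seq x n) ℚ.+ (seq y m ℚ.- seq y n) ∣
      ≤⟨ ℚ.∣p+q∣≤∣p∣+∣q∣ (seq x m ℚ.- seq x n) (seq y m ℚ.- seq y n) ⟩
    ℚ.∣ seq x m ℚ.- seq x n ∣ ℚ.+ ℚ.∣ seq y m ℚ.- seq y n ∣
      ≤⟨ ℚ.+-mono-≤
           (xM m n (ℕ.m⊔n≤o⇒m≤o M N M⊔N≤m) (ℕ.m⊔n≤o⇒m≤o M N M⊔N≤n))
           (yN m n (ℕ.m⊔n≤o⇒n≤o M N M⊔N≤m) (ℕ.m⊔n≤o⇒n≤o M N M⊔N≤n)) ⟩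
    ε ℚ.* ℚ.½ ℚ.+ ε ℚ.* ℚ.½
      ≡⟨ half+half ε ⟩
    ε ∎
  where open ℚ.≤-Reasoning

-_ : ℝ → ℝ
seq    (- x) n = ℚ.- seq x n
cauchy (- x) ε 0<ε with N , close ← cauchy x ε 0<ε =
  N , λ m n N≤m N≤n → subst (ℚ._≤ ε)
    (sym (trans (cong ℚ.∣_∣ (neg-minus (seq x m) (seq x n)))
                (ℚ.∣-p∣≡∣p∣ (seq x m ℚ.- seq x n))))
    (close m n N≤m N≤n)

_-_ : ℝ → ℝ → ℝ
x - y = x + (- y)

_*_ : ℝ → ℝ → ℝ
seq    (x * y) n = seq x n ℚ.* seq y n
cauchy (x * y) ε 0<ε
  with K , K>0 , A , x≤K ← bounded x
     | L , L>0 , B , y≤L ← bounded y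
  with η , 0<η , Kη ← quotient K (ε ℚ.* ℚ.½) K>0 (half>0 0<ε)
     | θ , 0<θ , Lθ ← quotient L (ε ℚ.* ℚ.½) L>0 (half>0 0<ε)
  with M , yM ← cauchy y η 0<η
     | N , xN ← cauchy x θ 0<θ =
  (A ℕ.⊔ B) ℕ.⊔ (M ℕ.⊔ N) , λ m n m≥ n≥ → begin
    ℚ.∣ seq x m ℚ.* seq y m ℚ.- seq x n ℚ.* seq y n ∣
      ≡⟨ cong ℚ.∣_∣ (*-minus (seq x m) (seq y m) (seq x n) (seq y n)) ⟩
    ℚ.∣ seq x m ℚ.* (seq y m ℚ.- seq y n) ℚ.+ seq y n ℚ.* (seq x m ℚ.- seq x n) ∣
      ≤⟨ ℚ.∣p+q∣≤∣p∣+∣q∣ (seq x m ℚ.* (seq y m ℚ.- seq y n))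
                         (seq y n ℚ.* (seq x m ℚ.- seq x n)) ⟩
    ℚ.∣ seq x m ℚ.* (seq y m ℚ.- seq y n) ∣ ℚ.+ ℚ.∣ seq y n ℚ.* (seq x m ℚ.- seq x n) ∣
      ≤⟨ ℚ.+-mono-≤
           (*-mono-abs (x≤K m (≥A m≥)) (yM m n (≥M m≥) (≥M n≥)))
           (*-mono-abs (y≤L n (≥B n≥)) (xN m n (≥N m≥) (≥N n≥))) ⟩
    K ℚ.* η ℚ.+ L ℚ.* θ
      ≡⟨ cong₂ ℚ._+_ Kη Lθ ⟩
    ε ℚ.* ℚ.½ ℚ.+ ε ℚ.* ℚ.½
      ≡⟨ half+half ε ⟩
    ε ∎
  where
  open ℚ.≤-Reasoning
  ≥A : ∀ {m} → (A ℕ.⊔ B) ℕ.⊔ (M ℕ.⊔ N) ℕ.≤ m → A ℕ.≤ m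
  ≥A h = ℕ.m⊔n≤o⇒m≤o A B (ℕ.m⊔n≤o⇒m≤o (A ℕ.⊔ B) (M ℕ.⊔ N) h)
  ≥B : ∀ {m} → (A ℕ.⊔ B) ℕ.⊔ (M ℕ.⊔ N) ℕ.≤ m → B ℕ.≤ m
  ≥B h = ℕ.m⊔n≤o⇒n≤o A B (ℕ.m⊔n≤o⇒m≤o (A ℕ.⊔ B) (M ℕ.⊔ N) h)
  ≥M : ∀ {m} → (A ℕ.⊔ B) ℕ.⊔ (M ℕ.⊔ N) ℕ.≤ m → M ℕ.≤ m
  ≥M h = ℕ.m⊔n≤o⇒m≤o M N (ℕ.m⊔n≤o⇒n≤o (A ℕ.⊔ B) (M ℕ.⊔ N) h)
  ≥N : ∀ {m} → (A ℕ.⊔ B) ℕ.⊔ (M ℕ.⊔ N) ℕ.≤ m → N ℕ.≤ m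
  ≥N h = ℕ.m⊔n≤o⇒n≤o M N (ℕ.m⊔n≤o⇒n≤o (A ℕ.⊔ B) (M ℕ.⊔ N) h)

⊔>0 : ∀ δ → ℚ.Positive δ → ∀ p → 0ℚ ℚ.< p ℚ.⊔ δ
⊔>0 δ δ>0 p = ℚ.<-≤-trans (ℚ.positive⁻¹ δ {{δ>0}}) (ℚ.p≤q⊔p p δ)

-- 1 / (p ⊔ δ), defined for every p when δ is positive.
recip : ∀ δ → ℚ.Positive δ → ℚ → ℚ
recip δ δ>0 p = (ℚ.1/ (p ℚ.⊔ δ)) {{ℚ.>-nonZero (⊔>0 δ δ>0 p)}}

recip-inverse : ∀ δ δ>0 p → δ ℚ.≤ p → p ℚ.* recip δ δ>0 p ≡ 1ℚ
recip-inverse δ δ>0 p δ≤p = trans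
  (cong (ℚ._* recip δ δ>0 p) (sym (ℚ.p≥q⇒p⊔q≡p δ≤p)))
  (ℚ.*-inverseʳ (p ℚ.⊔ δ) {{ℚ.>-nonZero (⊔>0 δ δ>0 p)}})

recip-positive : ∀ δ δ>0 p → ℚ.Positive (recip δ δ>0 p)
recip-positive δ δ>0 p = ℚ.1/pos⇒pos (p ℚ.⊔ δ)
  {{ℚ.positive (⊔>0 δ δ>0 p)}}

recip-bound : ∀ δ δ>0 p → δ ℚ.≤ p →
  ℚ.∣ recip δ δ>0 p ∣ ℚ.≤ recip δ δ>0 δ
recip-bound δ δ>0 p δ≤p = begin
  ℚ.∣ A ∣        ≡⟨ ℚ.0≤p⇒∣p∣≡p (ℚ.<⇒≤ (ℚ.positive⁻¹ A {{A>0}})) ⟩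
  A              ≡⟨ ℚ.*-identityʳ A ⟨
  A ℚ.* 1ℚ       ≡⟨ cong (A ℚ.*_) (recip-inverse δ δ>0 δ ℚ.≤-refl) ⟨
  A ℚ.* (δ ℚ.* D)  ≤⟨ ℚ.*-monoˡ-≤-nonNeg A {{ℚ.pos⇒nonNeg A {{A>0}}}}
                      (ℚ.*-monoʳ-≤-nonNeg D {{ℚ.pos⇒nonNeg D {{D>0}}}} δ≤p) ⟩
  A ℚ.* (p ℚ.* D)  ≡⟨ ℚ.*-assoc A p D ⟨
  A ℚ.* p ℚ.* D    ≡⟨ cong (ℚ._* D) (trans (ℚ.*-comm A p) (recip-inverse δ δ>0 p δ≤p)) ⟩
  1ℚ ℚ.* D       ≡⟨ ℚ.*-identityˡ D ⟩
  D              ∎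
  where
  open ℚ.≤-Reasoning
  A D : ℚ
  A = recip δ δ>0 p
  D = recip δ δ>0 δ
  A>0 : ℚ.Positive A
  A>0 = recip-positive δ δ>0 p
  D>0 : ℚ.Positive D
  D>0 = recip-positive δ δ>0 δ

recip-minus : ∀ p q A B → p ℚ.* A ≡ 1ℚ → q ℚ.* B ≡ 1ℚ →
  A ℚ.- B ≡ (A ℚ.* B) ℚ.* (q ℚ.- p)
recip-minus p q A B pA qB = sym (trans
  (sym (*-distribˡ-- (A ℚ.* B) q p))
  (cong₂ ℚ._-_
    (trans (ℚ.*-assoc A B q)
      (trans (cong (A ℚ.*_) (trans (ℚ.*-comm B q) qB)) (ℚ.*-identityʳ A)))
    (trans (cong (ℚ._* p) (ℚ.*-comm A B)) (trans (ℚ.*-assoc B A p)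
      (trans (cong (B ℚ.*_) (trans (ℚ.*-comm A p) pA)) (ℚ.*-identityʳ B))))))

-- The proof of 0ℝ < x supplies a rational δ > 0 that eventually bounds
-- x from below; the truncation at δ only affects finitely many terms, and
-- all other terms are the reciprocals of those of x.
inverse : ∀ x → 0ℝ < x → ℝ
seq    (inverse x (δ , 0<δ , _)) n = recip δ (ℚ.positive 0<δ) (seq x n)
cauchy (inverse x (δ , 0<δ , M , δ≤x)) ε 0<ε =
  let η , 0<η , DDη≡ε = quotient (D ℚ.* D) ε (ℚ.pos*pos⇒pos D {{D>0}} D {{D>0}}) 0<ε
      N , close       = cauchy x η 0<η
  in M ℕ.⊔ N , λ m n m≥ n≥ →
    let δ≤xm = below m (ℕ.m⊔n≤o⇒m≤o M N m≥)
        δ≤xn = below n (ℕ.m⊔n≤o⇒m≤o M N n≥)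
    in begin
    ℚ.∣ r m ℚ.- r n ∣
      ≡⟨ cong ℚ.∣_∣ (recip-minus (seq x m) (seq x n) (r m) (r n)
                      (recip-inverse δ δ>0 (seq x m) δ≤xm)
                      (recip-inverse δ δ>0 (seq x n) δ≤xn)) ⟩
    ℚ.∣ (r m ℚ.* r n) ℚ.* (seq x n ℚ.- seq x m) ∣
      ≤⟨ *-mono-abs
           (*-mono-abs (recip-bound δ δ>0 (seq x m) δ≤xm)
                       (recip-bound δ δ>0 (seq x n) δ≤xn))
           (close n m (ℕ.m⊔n≤o⇒n≤o M N n≥) (ℕ.m⊔n≤o⇒n≤o M N m≥)) ⟩
    (D ℚ.* D) ℚ.* η
      ≡⟨ DDη≡ε ⟩
    ε ∎
  where
  open ℚ.≤-Reasoning
  δ>0 : ℚ.Positive δ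
  δ>0 = ℚ.positive 0<δ
  D : ℚ
  D = recip δ δ>0 δ
  D>0 : ℚ.Positive D
  D>0 = recip-positive δ δ>0 δ
  r : ℕ → ℚ
  r n = recip δ δ>0 (seq x n)
  below : ∀ n → M ℕ.≤ n → δ ℚ.≤ seq x n
  below n M≤n = subst (ℚ._≤ seq x n) (ℚ.+-identityˡ δ) (δ≤x n M≤n)

_/_⟨_⟩ : (x y : ℝ) → 0ℝ < y → ℝ
x / y ⟨ 0<y ⟩ = x * inverse y 0<y

0<1+ : ∀ x → 0ℝ < x → 0ℝ < 1ℝ + x
0<1+ x (δ , 0<δ , N , δ≤x) = δ , 0<δ , N , λ n N≤n →
  subst (ℚ._≤ 1ℚ ℚ.+ seq x n) (ℚ.+-identityˡ (0ℚ ℚ.+ δ))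
    (ℚ.+-mono-≤ (ℚ.<⇒≤ (ℚ.positive⁻¹ 1ℚ)) (δ≤x n N≤n))

------------------------------------------------------------------------
-- Digraphs

-- The vertex set is Fin order.  Arcs are given by a relation of which only
-- the truth values matter, so there are no parallel arcs; opposite arcs are
-- allowed.
record Digraph : Set₁ where
  field
    order    : ℕ
    Arc      : Rel (Fin order) 0ℓ
    arc?     : Decidable₂ Arc
    loopless : Irreflexive _≡_ Arc

  V : Set
  V = Fin order

open Digraph public

subset : ∀ {n} {P : Pred (Fin n) 0ℓ} → Decidable P → Subset n
subset P? = tabulate (λ v → does (P? v))

Sink : (D : Digraph) → Pred (V D) 0ℓ
Sink D v = ∀ w → ¬ Arc D v w

Source : (D : Digraph) → Pred (V D) 0ℓ
Source D v = ∀ w → ¬ Arc D w v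

sink? : ∀ D → Decidable (Sink D)
sink? D v = all? (λ w → ¬? (arc? D v w))

source? : ∀ D → Decidable (Source D)
source? D v = all? (λ w → ¬? (arc? D w v))

SinkFree : Digraph → Set
SinkFree D = ∀ v → ¬ Sink D v

nonSinkSources : (D : Digraph) → Subset (order D)
nonSinkSources D = subset (λ v → source? D v ×-dec ¬? (sink? D v))

-- The sequence of vertices of a directed path from u to v with l arcs.
IsPath : (D : Digraph) (u v : V D) {l : ℕ} → Pred (Vec (V D) (suc l)) 0ℓ
IsPath D u v xs = head xs ≡ u × last xs ≡ v × Linked (Arc D) xs × Unique xs

-- dist(u,v) ≤ k for finite k, where dist(u,v) is the minimum (∞ if there is
-- none) of the lengths l of directed paths from u to v.
Dist≤ : (D : Digraph) (u v : V D) → ℕ → Set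
Dist≤ D u v k = ∃[ l ] l ℕ.≤ k × ∃[ xs ] IsPath D u v {l} xs

-- dist(u,S) ≤ k for finite k; it fails for every k when S is empty.
DistToSet≤ : (D : Digraph) → V D → Subset (order D) → ℕ → Set
DistToSet≤ D u S k = ∃[ v ] v ∈ S × Dist≤ D u v k

anyVec? : ∀ {n l} {P : Pred (Vec (Fin n) l) 0ℓ} → Decidable P → Dec (∃ P)
anyVec? {l = zero}  P? = map′ ([] ,_) (λ { ([] , p) → p }) (P? [])
anyVec? {l = suc l} P? =
  map′ (λ { (x , xs , p) → x ∷ xs , p }) (λ { (x ∷ xs , p) → x , xs , p })
       (any? (λ x → anyVec? (λ xs → P? (x ∷ xs))))

isPath? : ∀ D u v {l} → Decidable (IsPath D u v {l})
isPath? D u v xs =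
  (head xs ≟F u) ×-dec (last xs ≟F v) ×-dec linked? (arc? D) xs ×-dec
  allPairs? (λ x y → ¬? (x ≟F y)) xs

dist≤? : ∀ D u v k → Dec (Dist≤ D u v k)
dist≤? D u v k =
  map′ (λ { (l , l<1+k , p) → l , ℕ.s≤s⁻¹ l<1+k , p })
       (λ { (l , l≤k , p) → l , ℕ.s≤s l≤k , p })
       (ℕ.anyUpTo? (λ l → anyVec? (isPath? D u v {l})) (suc k))

distToSet≤? : ∀ D u S k → Dec (DistToSet≤ D u S k)
distToSet≤? D u S k = any? (λ v → (v ∈? S) ×-dec dist≤? D u v k)

N⁻[_,_] : (D : Digraph) → Subset (order D) → Subset (order D)
N⁻[ D , S ] = subset (λ u → distToSet≤? D u S 1)

Independent : (D : Digraph) → Subset (order D) → Set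
Independent D S = ∀ {u v} → u ∈ S → v ∈ S → ¬ Arc D u v

QuasiKernel : (D : Digraph) → Subset (order D) → Set
QuasiKernel D Q = Independent D Q × (∀ u → DistToSet≤ D u Q 2)

------------------------------------------------------------------------
-- The three statements and their sink-free versions

-- With n the number of vertices of D:  ∣Q∣ ≤ (1 - β)n,  ∣Q∣ ≤ n - βs  and
-- ∣N⁻[Q]∣ ≥ βn  respectively.
HasI HasII HasIII : ℝ → Digraph → Set
HasI β D = ∃[ Q ] QuasiKernel D Q ×
  fromℕ ∣ Q ∣ ≤ (1ℝ - β) * fromℕ (order D)
HasII β D = ∃[ Q ] QuasiKernel D Q ×
  fromℕ ∣ Q ∣ ≤ fromℕ (order D) - β * fromℕ ∣ nonSinkSources D ∣
HasIII β D = ∃[ Q ] QuasiKernel D Q ×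
  β * fromℕ (order D) ≤ fromℕ ∣ N⁻[ D , Q ] ∣

I II III IIˢᶠ IIIˢᶠ : ℝ → Set₁
I     β = ∀ D → SinkFree D → HasI β D
II    β = ∀ D → HasII β D
III   β = ∀ D → HasIII β D
IIˢᶠ  β = ∀ D → SinkFree D → HasII β D
IIIˢᶠ β = ∀ D → SinkFree D → HasIII β D

{-# OPTIONS --safe #-}
module Submission where

-- The three statements are tied together by the implications
--
--   I ⇒ IIˢᶠ ⇒ III ⇒ II ⇒ IIˢᶠ,   III ⇒ IIIˢᶠ ⇒ IIˢᶠ   and   II ⇒ I (α/(1+α)).
--
-- Those that only restrict the class of digraphs are immediate, and I ⇒ IIˢᶠ
-- holds because s ≤ n.  Three constructions carry the rest.
--
-- III ⇒ II (III-of-blowups⇒II).  Assign to every non-sink source v an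
-- out-neighbour f v, and apply III to the blow-up of D in which every vertex w
-- has k extra twins for each v with f v = w.  The projection Q of the resulting
-- quasi-kernel satisfies k·c + n ≥ αks, where c counts the v with f v ∈ N⁻[Q].
-- Now discard the non-sink sources from Q and add back those at distance more
-- than 2 from what is left; none of the c vertices counted above is added back,
-- so at most n - c vertices remain.  Hence the least size q of a quasi-kernel
-- of D satisfies kq + αks ≤ kn + n for every k, and letting k grow gives
-- q + αs ≤ n.  Blow-ups of sink-free digraphs are sink-free, so the same
-- construction yields IIIˢᶠ ⇒ IIˢᶠ.
--
-- IIˢᶠ ⇒ III (IIˢᶠ⇒HasIII).  Every quasi-kernel contains all sinks, so the set
-- U of vertices at distance at most 1 from a sink is covered anyway.  Take m
-- copies of D - U, attach k pendant sources to each of their vertices, and add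
-- m mutually adjacent hubs; in the i-th copy every vertex with an arc into U
-- gets an arc to the i-th hub.  This digraph is sink-free, and a quasi-kernel S
-- of it contains at most one hub.  If the i-th hub is not in S, then S induces
-- on the i-th copy, together with the sinks of D, a quasi-kernel of D, and S
-- contains the k pendants of each vertex that this quasi-kernel leaves outside
-- its closed in-neighbourhood.  If every quasi-kernel of D leaves at least c
-- vertices uncovered, then ∣S∣ ≥ (m - 1)kc.  Comparing with the bound on ∣S∣
-- from IIˢᶠ for m = k + 1 and letting k grow gives c + αn ≤ n, so a quasi-kernel
-- with the fewest uncovered vertices has ∣N⁻[Q]∣ ≥ αn.
--
-- II ⇒ I (α/(1+α)) (II⇒I).  Let Q be a quasi-kernel of least size in a
-- sink-free digraph.  Let A be the set of in-neighbours of Q, choose for each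
-- x ∈ A an out-neighbour g x ∈ Q, and put F = Q - g(A).  By minimality no q ∈ F
-- has an arc into A: otherwise Q - q would be a quasi-kernel.  So in the
-- subdigraph H induced on the complement of A ∪ g(A) the vertices of F are
-- sources but not sinks.  Take a quasi-kernel S of H as in II and add to it the
-- vertices of g(A) without an arc into S.  This is a quasi-kernel of D, so
-- ∣Q∣ ≤ ∣S∣ + ∣g(A)∣ ≤ ∣H∣ - α∣F∣ + ∣g(A)∣.  With α ≤ 1 and ∣g(A)∣ ≤ ∣A∣ this
-- gives (1 + α)∣Q∣ ≤ n.
--
-- No limit of quasi-kernels is taken: in both limit arguments the quasi-kernel
-- is fixed beforehand as an extremal one among the finitely many quasi-kernels
-- of D (argmin), and only the inequality passes to the limit (≼-archimedean).

open import Data.Empty using (⊥; ⊥-elim)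
open import Data.Fin using (Fin; zero; suc)
open import Data.Fin.Properties using (any?; all?) renaming (_≟_ to _≟F_)
open import Data.Fin.Subset as Sub using (Subset; ∣_∣; ⁅_⁆; inside; outside)
open import Data.Fin.Subset.Properties using (_∈?_; anySubset?; drop-there; p─q⊆p; ∣p∣≤n; x∈⁅x⁆; ∣⁅x⁆∣≡1; x∈p∧x≢y⇒x∈p-y; x∈p⇒∣p-x∣<∣p∣)
import Data.Integer as ℤ
import Data.Integer.Properties as ℤ
open import Data.List as List using (List; []; _∷_; _++_; length; filter; map; concat; concatMap; replicate; allFin; lookup)
open import Data.List.Membership.Propositional using (_∈_; lose; find)
open import Data.List.Membership.Propositional.Properties using (∈-allFin; ∈-lookup; ∈-++⁺ˡ; ∈-++⁺ʳ; ∈-++⁻; ∈-map⁺; ∈-map⁻; ∈-filter⁺; ∈-filter⁻; ∈-concatMap⁺; ∈-concatMap⁻)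
open import Data.List.Properties using (filter-++; filter-all; length-++; length-filter; length-map; length-tabulate; map-tabulate; tabulate-lookup)
import Data.List.Relation.Unary.All as All
open import Data.List.Relation.Unary.Any as Any using (here; there)
open import Data.List.Relation.Unary.Any.Properties using (lookup-index)
open import Data.Nat as ℕ using (ℕ; zero; suc; z≤n; s≤s)
open import Data.Nat.Induction using (<-wellFounded)
import Data.Nat.Properties as ℕ
open import Data.Nat.Solver renaming (module +-*-Solver to ℕ-Solver)
open import Data.Product using (∃; ∃-syntax; _×_; _,_; proj₁; proj₂)
open import Data.Rational as ℚ using (ℚ; mkℚ; 0ℚ; 1ℚ)
import Data.Rational.Properties as ℚ
open import Data.Rational.Solver renaming (module +-*-Solver to ℚ-Solver)
import Data.Rational.Unnormalised as ℚᵘ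
import Data.Rational.Unnormalised.Properties as ℚᵘ
open import Data.Sum using (_⊎_; inj₁; inj₂; [_,_]′)
open import Data.Unit using (⊤; tt)
open import Data.Vec using ([]; _∷_; here; there)
open import Data.Vec.Properties using (lookup∘tabulate; []=⇒lookup; lookup⇒[]=)
open import Data.Vec.Relation.Unary.All using ([]; _∷_)
open import Data.Vec.Relation.Unary.AllPairs using ([]; _∷_)
open import Data.Vec.Relation.Unary.Linked using ([-]; _∷_)
open import Function using (_∘_; id; case_of_)
open import Function.Bundles using (_⇔_; mk⇔)
open import Induction.WellFounded using (Acc; acc)
open import Level using (0ℓ)
open import Relation.Binary using (Rel; Irreflexive; DecidableEquality) renaming (Decidable to Decidable₂)
open import Relation.Binary.PropositionalEquality
open import Relation.Nullary using (¬_; yes; no; does; _×-dec_; _⊎-dec_; ¬?)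
open import Relation.Nullary.Decidable using (map′; _→-dec_; dec-true)
open import Relation.Unary using (Pred; Decidable)
open import Relation.Unary.Properties using (U?)
open import Defs

-- Affine inequalities between natural numbers and α

-- The rational number n, as in fromℕ.
ι : ℕ → ℚ
ι n = ℤ.+ n ℚ./ 1

toℚᵘ-ι : ∀ n → ℚ.toℚᵘ (ι n) ℚᵘ.≃ ℚᵘ.mkℚᵘ (ℤ.+ n) 0
toℚᵘ-ι n = ℚ.toℚᵘ-fromℚᵘ (ℚᵘ.mkℚᵘ (ℤ.+ n) 0)

ι-+ : ∀ m n → ι (m ℕ.+ n) ≡ ι m ℚ.+ ι n
ι-+ m n = ℚ.toℚᵘ-injective (begin
  ℚ.toℚᵘ (ι (m ℕ.+ n))                   ≈⟨ toℚᵘ-ι (m ℕ.+ n) ⟩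
  ℚᵘ.mkℚᵘ (ℤ.+ (m ℕ.+ n)) 0               
    ≈⟨ ℚᵘ.*≡* (cong (ℤ._* ℤ.1ℤ)
         (cong₂ ℤ._+_ (sym (ℤ.*-identityʳ (ℤ.+ m))) (sym (ℤ.*-identityʳ (ℤ.+ n))))) ⟩
  ℚᵘ.mkℚᵘ (ℤ.+ m) 0 ℚᵘ.+ ℚᵘ.mkℚᵘ (ℤ.+ n) 0 ≈⟨ ℚᵘ.+-cong (toℚᵘ-ι m) (toℚᵘ-ι n) ⟨
  ℚ.toℚᵘ (ι m) ℚᵘ.+ ℚ.toℚᵘ (ι n)          ≈⟨ ℚ.toℚᵘ-homo-+ (ι m) (ι n) ⟨
  ℚ.toℚᵘ (ι m ℚ.+ ι n)                   ∎)
  where open import Relation.Binary.Reasoning.Setoid ℚᵘ.≃-setoid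

ι-* : ∀ m n → ι (m ℕ.* n) ≡ ι m ℚ.* ι n
ι-* m n = ℚ.toℚᵘ-injective (begin
  ℚ.toℚᵘ (ι (m ℕ.* n))                   ≈⟨ toℚᵘ-ι (m ℕ.* n) ⟩
  ℚᵘ.mkℚᵘ (ℤ.+ (m ℕ.* n)) 0               ≈⟨ ℚᵘ.*≡* (cong (ℤ._* ℤ.1ℤ) (ℤ.pos-* m n)) ⟩
  ℚᵘ.mkℚᵘ (ℤ.+ m) 0 ℚᵘ.* ℚᵘ.mkℚᵘ (ℤ.+ n) 0 ≈⟨ ℚᵘ.*-cong (toℚᵘ-ι m) (toℚᵘ-ι n) ⟨
  ℚ.toℚᵘ (ι m) ℚᵘ.* ℚ.toℚᵘ (ι n)          ≈⟨ ℚ.toℚᵘ-homo-* (ι m) (ι n) ⟨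
  ℚ.toℚᵘ (ι m ℚ.* ι n)                   ∎)
  where open import Relation.Binary.Reasoning.Setoid ℚᵘ.≃-setoid

0≤ι : ∀ n → 0ℚ ℚ.≤ ι n
0≤ι n = ℚ.nonNegative⁻¹ (ι n) {{ℚ.normalize-nonNeg n 1}}

ι-mono : ∀ {m n} → m ℕ.≤ n → ι m ℚ.≤ ι n
ι-mono {m} {n} m≤n = begin
  ι m                  ≡⟨ ℚ.+-identityʳ (ι m) ⟨
  ι m ℚ.+ 0ℚ           ≤⟨ ℚ.+-monoʳ-≤ (ι m) (0≤ι (n ℕ.∸ m)) ⟩
  ι m ℚ.+ ι (n ℕ.∸ m)  ≡⟨ ι-+ m (n ℕ.∸ m) ⟨
  ι (m ℕ.+ (n ℕ.∸ m))  ≡⟨ cong ι (ℕ.m+[n∸m]≡n m≤n) ⟩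
  ι n                  ∎
  where open ℚ.≤-Reasoning

ι-suc-positive : ∀ k → ℚ.Positive (ι (suc k))
ι-suc-positive k = ℚ.positive (ℚ.<-≤-trans (ℚ.positive⁻¹ 1ℚ) (ι-mono (ℕ.s≤s (ℕ.z≤n {k}))))

scale-affine : ∀ k a c t →
  ι k ℚ.* (ι a ℚ.+ t ℚ.* ι c) ≡ ι (k ℕ.* a) ℚ.+ t ℚ.* ι (k ℕ.* c)
scale-affine k a c t = trans
  (solve 4 (λ k x t y → k :* (x :+ t :* y) := k :* x :+ t :* (k :* y))
    refl (ι k) (ι a) t (ι c))
  (sym (cong₂ (λ x y → x ℚ.+ t ℚ.* y) (ι-* k a) (ι-* k c)))
  where open ℚ-Solver

archimedean : ∀ ε → 0ℚ ℚ.< ε → ∀ d → ∃[ k ] ι d ℚ.≤ ι (suc k) ℚ.* ε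
archimedean ε@(mkℚ (ℤ.+ zero) q-1 c) (ℚ.*<* (ℤ.+<+ ())) d
archimedean ε@(mkℚ (ℤ.+ (suc p)) q-1 c) 0<ε d = k , ℚ.toℚᵘ-cancel-≤ (begin
  ℚ.toℚᵘ (ι d)                            ≃⟨ toℚᵘ-ι d ⟩
  ℚᵘ.mkℚᵘ (ℤ.+ d) 0
    ≤⟨ ℚᵘ.*≤* (subst₂ ℤ._≤_ (ℤ.pos-* d _) (ℤ.pos-* (suc k ℕ.* suc p) 1) (ℤ.+≤+ bound)) ⟩
  ℚᵘ.mkℚᵘ (ℤ.+ (suc k)) 0 ℚᵘ.* ℚ.toℚᵘ ε  ≃⟨ ℚᵘ.*-congʳ (toℚᵘ-ι (suc k)) ⟨
  ℚ.toℚᵘ (ι (suc k)) ℚᵘ.* ℚ.toℚᵘ ε       ≃⟨ ℚ.toℚᵘ-homo-* (ι (suc k)) ε ⟨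
  ℚ.toℚᵘ (ι (suc k) ℚ.* ε)               ∎)
  where
  open ℚᵘ.≤-Reasoning
  -- d times the denominator of ε
  k : ℕ
  k = d ℕ.* suc q-1
  bound : d ℕ.* (1 ℕ.* suc q-1) ℕ.≤ suc k ℕ.* suc p ℕ.* 1
  bound = ℕ.≤-trans (ℕ.≤-reflexive (cong (d ℕ.*_) (ℕ.*-identityˡ (suc q-1))))
    (ℕ.≤-trans (ℕ.n≤1+n k)
      (ℕ.≤-trans (ℕ.m≤m*n (suc k) (suc p)) (ℕ.≤-reflexive (sym (ℕ.*-identityʳ _)))))
archimedean (mkℚ ℤ.-[1+ _ ] _ _) (ℚ.*<* ()) d

-- P holds for all sufficiently large indices.
Eventually : (ℕ → Set) → Set
Eventually P = ∃[ N ] (∀ n → N ℕ.≤ n → P n)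

eventually-map₂ : {P Q R : ℕ → Set} → (∀ n → P n → Q n → R n) →
  Eventually P → Eventually Q → Eventually R
eventually-map₂ f (M , p) (N , q) = M ℕ.⊔ N , λ n h →
  f n (p n (ℕ.m⊔n≤o⇒m≤o M N h)) (q n (ℕ.m⊔n≤o⇒n≤o M N h))

eventually-map : {P Q : ℕ → Set} → (∀ n → P n → Q n) → Eventually P → Eventually Q
eventually-map f (M , p) = M , λ n h → f n (p n h)

infix 4 _⊕_·_≼_

-- The real inequality a + cα ≤ b.  All bounds below are of this form.  It is a
-- record so that a, c, α and b can be inferred from the type.
record _⊕_·_≼_ (a c : ℕ) (α : ℝ) (b : ℕ) : Set where
  constructor affine
  field
    within : ∀ ε → 0ℚ ℚ.< ε →
      Eventually (λ n → ι a ℚ.+ seq α n ℚ.* ι c ℚ.≤ ι b ℚ.+ ε)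

open _⊕_·_≼_

eventually-nonneg : ∀ {α} → 0ℝ < α → Eventually (λ n → 0ℚ ℚ.≤ seq α n)
eventually-nonneg (δ , 0<δ , δ≤α) = eventually-map
  (λ n δ≤αₙ → ℚ.≤-trans (ℚ.<⇒≤ 0<δ) (subst (ℚ._≤ _) (ℚ.+-identityˡ δ) δ≤αₙ)) δ≤α

module _ {α : ℝ} where

  ≼-mono : ∀ {a a′ c c′ b b′} → 0ℝ < α → a′ ℕ.≤ a → c′ ℕ.≤ c → b ℕ.≤ b′ →
    a ⊕ c · α ≼ b → a′ ⊕ c′ · α ≼ b′
  ≼-mono 0<α a′≤a c′≤c b≤b′ h .within ε 0<ε = eventually-map₂
    (λ n 0≤αₙ hₙ → ℚ.≤-trans
      (ℚ.+-mono-≤ (ι-mono a′≤a)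
        (ℚ.*-monoˡ-≤-nonNeg (seq α n) {{ℚ.nonNegative 0≤αₙ}} (ι-mono c′≤c)))
      (ℚ.≤-trans hₙ (ℚ.+-monoˡ-≤ ε (ι-mono b≤b′))))
    (eventually-nonneg {α} 0<α) (h .within ε 0<ε)

  ≼-add : ∀ {a a′ c c′ b b′} → a ⊕ c · α ≼ b → a′ ⊕ c′ · α ≼ b′ →
    a ℕ.+ a′ ⊕ c ℕ.+ c′ · α ≼ b ℕ.+ b′
  ≼-add {a} {a′} {c} {c′} {b} {b′} h h′ .within ε 0<ε = eventually-map₂
    (λ n hₙ h′ₙ → begin
      ι (a ℕ.+ a′) ℚ.+ seq α n ℚ.* ι (c ℕ.+ c′)
        ≡⟨ cong₂ (λ x y → x ℚ.+ seq α n ℚ.* y) (ι-+ a a′) (ι-+ c c′) ⟩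
      (ι a ℚ.+ ι a′) ℚ.+ seq α n ℚ.* (ι c ℚ.+ ι c′)
        ≡⟨ solve 5 (λ x y t u v → (x :+ y) :+ t :* (u :+ v) := (x :+ t :* u) :+ (y :+ t :* v))
             refl (ι a) (ι a′) (seq α n) (ι c) (ι c′) ⟩
      (ι a ℚ.+ seq α n ℚ.* ι c) ℚ.+ (ι a′ ℚ.+ seq α n ℚ.* ι c′)
        ≤⟨ ℚ.+-mono-≤ hₙ h′ₙ ⟩
      (ι b ℚ.+ ε ℚ.* ℚ.½) ℚ.+ (ι b′ ℚ.+ ε ℚ.* ℚ.½)
        ≡⟨ solve 3 (λ x y e → (x :+ e) :+ (y :+ e) := (x :+ y) :+ (e :+ e))
             refl (ι b) (ι b′) (ε ℚ.* ℚ.½) ⟩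
      (ι b ℚ.+ ι b′) ℚ.+ (ε ℚ.* ℚ.½ ℚ.+ ε ℚ.* ℚ.½)
        ≡⟨ cong₂ ℚ._+_ (sym (ι-+ b b′)) (half+half ε) ⟩
      ι (b ℕ.+ b′) ℚ.+ ε ∎)
    (h .within (ε ℚ.* ℚ.½) (half>0 0<ε)) (h′ .within (ε ℚ.* ℚ.½) (half>0 0<ε))
    where
    open ℚ.≤-Reasoning
    open ℚ-Solver

  ≼-shift : ∀ {a c b} d → a ⊕ c · α ≼ b → d ℕ.+ a ⊕ c · α ≼ d ℕ.+ b
  ≼-shift d = ≼-add {a = d} {c = 0} {b = d} (affine λ ε 0<ε → 0 , λ n _ → begin
    ι d ℚ.+ seq α n ℚ.* 0ℚ  ≡⟨ cong (ι d ℚ.+_) (ℚ.*-zeroʳ (seq α n)) ⟩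
    ι d ℚ.+ 0ℚ              ≤⟨ ℚ.+-monoʳ-≤ (ι d) (ℚ.<⇒≤ 0<ε) ⟩
    ι d ℚ.+ ε               ∎)
    where open ℚ.≤-Reasoning

  ≼-cancel : ∀ {a c b} d → a ℕ.+ d ⊕ c · α ≼ b ℕ.+ d → a ⊕ c · α ≼ b
  ≼-cancel {a} {c} {b} d h .within ε 0<ε = eventually-map
    (λ n hₙ → begin
      ι a ℚ.+ seq α n ℚ.* ι c
        ≡⟨ solve 3 (λ x y z → x :+ y := ((x :+ z) :+ y) :+ (:- z))
             refl (ι a) (seq α n ℚ.* ι c) (ι d) ⟩
      (ι a ℚ.+ ι d) ℚ.+ seq α n ℚ.* ι c ℚ.- ι d
        ≡⟨ cong (λ x → x ℚ.+ seq α n ℚ.* ι c ℚ.- ι d) (ι-+ a d) ⟨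
      ι (a ℕ.+ d) ℚ.+ seq α n ℚ.* ι c ℚ.- ι d
        ≤⟨ ℚ.+-monoˡ-≤ (ℚ.- ι d) hₙ ⟩
      ι (b ℕ.+ d) ℚ.+ ε ℚ.- ι d
        ≡⟨ cong (λ x → x ℚ.+ ε ℚ.- ι d) (ι-+ b d) ⟩
      (ι b ℚ.+ ι d) ℚ.+ ε ℚ.- ι d
        ≡⟨ solve 3 (λ x y z → ((x :+ z) :+ y) :+ (:- z) := x :+ y)
             refl (ι b) ε (ι d) ⟩
      ι b ℚ.+ ε ∎)
    (h .within ε 0<ε)
    where
    open ℚ.≤-Reasoning
    open ℚ-Solver

  -- α ≤ 1, which is all that the bound ½ on α is needed for.
  ≼-unit : ∀ c → α ≤ ½ℝ → 0 ⊕ c · α ≼ c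
  ≼-unit c α≤½ .within ε 0<ε = eventually-map
    (λ n αₙ≤1 → begin
      0ℚ ℚ.+ seq α n ℚ.* ι c  ≡⟨ ℚ.+-identityˡ _ ⟩
      seq α n ℚ.* ι c         ≤⟨ ℚ.*-monoʳ-≤-nonNeg (ι c) {{ℚ.nonNegative (0≤ι c)}} αₙ≤1 ⟩
      1ℚ ℚ.* ι c              ≡⟨ trans (ℚ.*-identityˡ (ι c)) (sym (ℚ.+-identityʳ (ι c))) ⟩
      ι c ℚ.+ 0ℚ              ≤⟨ ℚ.+-monoʳ-≤ (ι c) (ℚ.<⇒≤ 0<ε) ⟩
      ι c ℚ.+ ε               ∎)
    (α≤½ ℚ.½ (ℚ.positive⁻¹ ℚ.½))
    where open ℚ.≤-Reasoning

  ≼-unscale : ∀ {a c b} k → suc k ℕ.* a ⊕ suc k ℕ.* c · α ≼ suc k ℕ.* b → a ⊕ c · α ≼ b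
  ≼-unscale {a} {c} {b} k h .within ε 0<ε = eventually-map
    (λ n hₙ → ℚ.*-cancelˡ-≤-pos K {{K>0}} (begin
      K ℚ.* (ι a ℚ.+ seq α n ℚ.* ι c)
        ≡⟨ scale-affine (suc k) a c (seq α n) ⟩
      ι (suc k ℕ.* a) ℚ.+ seq α n ℚ.* ι (suc k ℕ.* c)
        ≤⟨ hₙ ⟩
      ι (suc k ℕ.* b) ℚ.+ K ℚ.* ε
        ≡⟨ cong (ℚ._+ K ℚ.* ε) (ι-* (suc k) b) ⟩
      K ℚ.* ι b ℚ.+ K ℚ.* ε
        ≡⟨ ℚ.*-distribˡ-+ K (ι b) ε ⟨
      K ℚ.* (ι b ℚ.+ ε) ∎))
    (h .within (K ℚ.* ε)
      (ℚ.positive⁻¹ (K ℚ.* ε) {{ℚ.pos*pos⇒pos K {{K>0}} ε {{ℚ.positive 0<ε}}}}))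
    where
    open ℚ.≤-Reasoning
    K : ℚ
    K = ι (suc k)
    K>0 : ℚ.Positive K
    K>0 = ι-suc-positive k

  -- Divide by k and let k tend to infinity.
  ≼-archimedean : ∀ {a c b} d →
    (∀ k → suc k ℕ.* a ⊕ suc k ℕ.* c · α ≼ suc k ℕ.* b ℕ.+ d) → a ⊕ c · α ≼ b
  -- The hypothesis is used for a single k, with (k + 1)ε ≥ d + 1, and with
  -- error 1, so that the total error is absorbed by (k + 1)ε.
  ≼-archimedean {a} {c} {b} d h .within ε 0<ε
    with k , d+1≤Kε ← archimedean ε 0<ε (d ℕ.+ 1) = eventually-map
    (λ n hₙ → ℚ.*-cancelˡ-≤-pos K {{K>0}} (begin
      K ℚ.* (ι a ℚ.+ seq α n ℚ.* ι c)
        ≡⟨ scale-affine (suc k) a c (seq α n) ⟩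
      ι (suc k ℕ.* a) ℚ.+ seq α n ℚ.* ι (suc k ℕ.* c)
        ≤⟨ hₙ ⟩
      ι (suc k ℕ.* b ℕ.+ d) ℚ.+ 1ℚ
        ≡⟨ ι-+ (suc k ℕ.* b ℕ.+ d) 1 ⟨
      ι (suc k ℕ.* b ℕ.+ d ℕ.+ 1)
        ≡⟨ cong ι (ℕ.+-assoc (suc k ℕ.* b) d 1) ⟩
      ι (suc k ℕ.* b ℕ.+ (d ℕ.+ 1))
        ≡⟨ trans (ι-+ (suc k ℕ.* b) (d ℕ.+ 1)) (cong (ℚ._+ ι (d ℕ.+ 1)) (ι-* (suc k) b)) ⟩
      K ℚ.* ι b ℚ.+ ι (d ℕ.+ 1)
        ≤⟨ ℚ.+-monoʳ-≤ (K ℚ.* ι b) d+1≤Kε ⟩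
      K ℚ.* ι b ℚ.+ K ℚ.* ε
        ≡⟨ ℚ.*-distribˡ-+ K (ι b) ε ⟨
      K ℚ.* (ι b ℚ.+ ε) ∎))
    (h k .within 1ℚ (ℚ.positive⁻¹ 1ℚ))
    where
    open ℚ.≤-Reasoning
    K : ℚ
    K = ι (suc k)
    K>0 : ℚ.Positive K
    K>0 = ι-suc-positive k

-- The bounds in the statements as affine inequalities

≤-minus⇒ : ∀ {p q r ε} → p ℚ.≤ q ℚ.- r ℚ.+ ε → p ℚ.+ r ℚ.≤ q ℚ.+ ε
≤-minus⇒ {p} {q} {r} {ε} h = begin
  p ℚ.+ r              ≤⟨ ℚ.+-monoˡ-≤ r h ⟩
  q ℚ.- r ℚ.+ ε ℚ.+ r  ≡⟨ solve 3 (λ x y z → x :+ (:- y) :+ z :+ y := x :+ z) refl q r ε ⟩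
  q ℚ.+ ε              ∎
  where
  open ℚ.≤-Reasoning
  open ℚ-Solver

≤-minus⇐ : ∀ {p q r ε} → p ℚ.+ r ℚ.≤ q ℚ.+ ε → p ℚ.≤ q ℚ.- r ℚ.+ ε
≤-minus⇐ {p} {q} {r} {ε} h = begin
  p                    ≡⟨ solve 2 (λ x y → x := x :+ y :+ (:- y)) refl p r ⟩
  p ℚ.+ r ℚ.- r        ≤⟨ ℚ.+-monoˡ-≤ (ℚ.- r) h ⟩
  q ℚ.+ ε ℚ.- r        ≡⟨ solve 3 (λ x y z → x :+ z :+ (:- y) := x :+ (:- y) :+ z) refl q r ε ⟩
  q ℚ.- r ℚ.+ ε        ∎
  where
  open ℚ.≤-Reasoning
  open ℚ-Solver

module _ {α : ℝ} where

  II-bound⇒ : ∀ {q n s} → fromℕ q ≤ fromℕ n - α * fromℕ s → q ⊕ s · α ≼ n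
  II-bound⇒ {n = n} h .within ε 0<ε = eventually-map (λ _ → ≤-minus⇒ {q = ι n} {ε = ε}) (h ε 0<ε)

  II-bound⇐ : ∀ {q n s} → q ⊕ s · α ≼ n → fromℕ q ≤ fromℕ n - α * fromℕ s
  II-bound⇐ {n = n} h ε 0<ε = eventually-map (λ _ → ≤-minus⇐ {q = ι n} {ε = ε}) (h .within ε 0<ε)

  III-bound⇒ : ∀ {n m} → α * fromℕ n ≤ fromℕ m → 0 ⊕ n · α ≼ m
  III-bound⇒ h .within ε 0<ε = eventually-map
    (λ _ → subst (ℚ._≤ _) (sym (ℚ.+-identityˡ _))) (h ε 0<ε)

  III-bound⇐ : ∀ {n m} → 0 ⊕ n · α ≼ m → α * fromℕ n ≤ fromℕ m
  III-bound⇐ h ε 0<ε = eventually-map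
    (λ _ → subst (ℚ._≤ _) (ℚ.+-identityˡ _)) (h .within ε 0<ε)

  I-bound⇒ : ∀ {q n} → fromℕ q ≤ (1ℝ - α) * fromℕ n → q ⊕ n · α ≼ n
  I-bound⇒ {q} {n} h .within ε 0<ε = eventually-map
    (λ k hₖ → ≤-minus⇒ {q = ι n} {ε = ε} (subst (λ x → ι q ℚ.≤ x ℚ.+ ε)
      (solve 2 (λ t x → (con 1ℚ :+ (:- t)) :* x := x :+ (:- (t :* x))) refl (seq α k) (ι n))
      hₖ))
    (h ε 0<ε)
    where open ℚ-Solver

-- (1 + α)q ≤ n implies q ≤ (1 - α/(1+α))n, because 1 - α/(1+α) = 1/(1+α).
I-bound⇐ : ∀ {α} (0<α : 0ℝ < α) {q n} → q ⊕ q · α ≼ n →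
  fromℕ q ≤ (1ℝ - α / (1ℝ + α) ⟨ 0<1+ α 0<α ⟩) * fromℕ n
I-bound⇐ {α} 0<α@(δ , 0<δ , δ≤α) {q} {n} h ε 0<ε = eventually-map₂
  (λ k δ≤αₖ hₖ → goal (seq α k) (subst (ℚ._≤ seq α k) (ℚ.+-identityˡ δ) δ≤αₖ) hₖ)
  δ≤α (h .within ε 0<ε)
  where
  open ℚ.≤-Reasoning
  open ℚ-Solver
  δ>0 : ℚ.Positive δ
  δ>0 = ℚ.positive 0<δ
  goal : ∀ t → δ ℚ.≤ t → ι q ℚ.+ t ℚ.* ι q ℚ.≤ ι n ℚ.+ ε →
    ι q ℚ.≤ (1ℚ ℚ.- t ℚ.* recip δ δ>0 (1ℚ ℚ.+ t)) ℚ.* ι n ℚ.+ ε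
  goal t δ≤t ht = begin
    ι q
      ≡⟨ trans (cong (ℚ._* ι q) inv) (ℚ.*-identityˡ (ι q)) ⟨
    (1ℚ ℚ.+ t) ℚ.* r ℚ.* ι q
      ≡⟨ solve 3 (λ t r q → (con 1ℚ :+ t) :* r :* q := r :* (q :+ t :* q)) refl t r (ι q) ⟩
    r ℚ.* (ι q ℚ.+ t ℚ.* ι q)
      ≤⟨ ℚ.*-monoˡ-≤-nonNeg r {{ℚ.nonNegative 0≤r}} ht ⟩
    r ℚ.* (ι n ℚ.+ ε)
      ≡⟨ ℚ.*-distribˡ-+ r (ι n) ε ⟩
    r ℚ.* ι n ℚ.+ r ℚ.* ε
      ≤⟨ ℚ.+-monoʳ-≤ (r ℚ.* ι n) (ℚ.*-monoʳ-≤-nonNeg ε {{ℚ.nonNegative (ℚ.<⇒≤ 0<ε)}} r≤1) ⟩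
    r ℚ.* ι n ℚ.+ 1ℚ ℚ.* ε
      ≡⟨ cong₂ (λ x y → x ℚ.* ι n ℚ.+ y) r≡ (ℚ.*-identityˡ ε) ⟩
    (1ℚ ℚ.- t ℚ.* r) ℚ.* ι n ℚ.+ ε ∎
    where
    -- r = 1/(1 + t), since δ ≤ 1 + t.
    r : ℚ
    r = recip δ δ>0 (1ℚ ℚ.+ t)
    0≤t : 0ℚ ℚ.≤ t
    0≤t = ℚ.≤-trans (ℚ.<⇒≤ 0<δ) δ≤t
    0≤r : 0ℚ ℚ.≤ r
    0≤r = ℚ.<⇒≤ (ℚ.positive⁻¹ r {{recip-positive δ δ>0 (1ℚ ℚ.+ t)}})
    δ≤1+t : δ ℚ.≤ 1ℚ ℚ.+ t
    δ≤1+t = subst (ℚ._≤ 1ℚ ℚ.+ t) (ℚ.+-identityˡ δ)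
      (ℚ.+-mono-≤ (ℚ.<⇒≤ (ℚ.positive⁻¹ 1ℚ)) δ≤t)
    inv : (1ℚ ℚ.+ t) ℚ.* r ≡ 1ℚ
    inv = recip-inverse δ δ>0 (1ℚ ℚ.+ t) δ≤1+t
    r≡ : r ≡ 1ℚ ℚ.- t ℚ.* r
    r≡ = trans
      (solve 2 (λ t r → r := (con 1ℚ :+ t) :* r :+ (:- (t :* r))) refl t r)
      (cong (ℚ._- t ℚ.* r) inv)
    r≤1 : r ℚ.≤ 1ℚ
    r≤1 = begin
      r                ≡⟨ ℚ.+-identityʳ r ⟨
      r ℚ.+ 0ℚ         ≤⟨ ℚ.+-monoʳ-≤ r 0≤t*r ⟩
      r ℚ.+ t ℚ.* r    ≡⟨ solve 2 (λ t r → r :+ t :* r := (con 1ℚ :+ t) :* r) refl t r ⟩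
      (1ℚ ℚ.+ t) ℚ.* r ≡⟨ inv ⟩
      1ℚ               ∎
      where
      0≤t*r : 0ℚ ℚ.≤ t ℚ.* r
      0≤t*r = ℚ.nonNegative⁻¹ (t ℚ.* r)
        {{ℚ.nonNeg*nonNeg⇒nonNeg t {{ℚ.nonNegative 0≤t}} r {{ℚ.nonNegative 0≤r}}}}

-- Counting

module _ {A : Set} where

  -- The number of entries of a list with a given property, with multiplicity.
  count : {P : Pred A 0ℓ} → Decidable P → List A → ℕ
  count P? xs = length (filter P? xs)

  module _ {P Q : Pred A 0ℓ} (P? : Decidable P) (Q? : Decidable Q) where

    count-mono : ∀ xs → (∀ {x} → x ∈ xs → P x → Q x) →
      count P? xs ℕ.≤ count Q? xs
    count-mono [] f = z≤n
    count-mono (x ∷ xs) f with P? x | Q? x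
    ... | yes p | yes q = s≤s (count-mono xs (f ∘ there))
    ... | yes p | no ¬q = ⊥-elim (¬q (f (here refl) p))
    ... | no ¬p | yes q = ℕ.m≤n⇒m≤1+n (count-mono xs (f ∘ there))
    ... | no ¬p | no ¬q = count-mono xs (f ∘ there)

    module _ {R : Pred A 0ℓ} (R? : Decidable R) where

      count-∪ : ∀ xs → (∀ {x} → R x → P x ⊎ Q x) →
        count R? xs ℕ.≤ count P? xs ℕ.+ count Q? xs
      count-∪ [] f = z≤n
      count-∪ (x ∷ xs) f with R? x | P? x | Q? x
      ... | no  _ | no  _ | no  _ = count-∪ xs f
      ... | no  _ | yes _ | no  _ = ℕ.m≤n⇒m≤1+n (count-∪ xs f)
      ... | no  _ | no  _ | yes _ = ℕ.≤-trans (count-∪ xs f) (ℕ.+-monoʳ-≤ _ (ℕ.n≤1+n _))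
      ... | no  _ | yes _ | yes _ = ℕ.m≤n⇒m≤1+n (ℕ.≤-trans (count-∪ xs f) (ℕ.+-monoʳ-≤ _ (ℕ.n≤1+n _)))
      ... | yes r | no ¬p | no ¬q = ⊥-elim ([ ¬p , ¬q ]′ (f r))
      ... | yes _ | yes _ | no  _ = s≤s (count-∪ xs f)
      ... | yes _ | no  _ | yes _ = ℕ.≤-trans (s≤s (count-∪ xs f)) (ℕ.≤-reflexive (sym (ℕ.+-suc _ _)))
      ... | yes _ | yes _ | yes _ = s≤s (ℕ.≤-trans (count-∪ xs f) (ℕ.+-monoʳ-≤ _ (ℕ.n≤1+n _)))

      count-disjoint : ∀ xs → (∀ {x} → P x → ¬ Q x) →
        (∀ {x} → P x → R x) → (∀ {x} → Q x → R x) →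
        count P? xs ℕ.+ count Q? xs ℕ.≤ count R? xs
      count-disjoint [] d f g = z≤n
      count-disjoint (x ∷ xs) d f g with R? x | P? x | Q? x
      ... | _     | yes p | yes q = ⊥-elim (d p q)
      ... | no ¬r | yes p | _     = ⊥-elim (¬r (f p))
      ... | no ¬r | _     | yes q = ⊥-elim (¬r (g q))
      ... | no  _ | no  _ | no  _ = count-disjoint xs d f g
      ... | yes _ | no  _ | no  _ = ℕ.m≤n⇒m≤1+n (count-disjoint xs d f g)
      ... | yes _ | yes _ | no  _ = s≤s (count-disjoint xs d f g)
      ... | yes _ | no  _ | yes _ = ℕ.≤-trans (ℕ.≤-reflexive (ℕ.+-suc _ _)) (s≤s (count-disjoint xs d f g))

  count-disjoint-length : {P Q : Pred A 0ℓ} (P? : Decidable P) (Q? : Decidable Q) → ∀ xs →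
    (∀ {x} → P x → ¬ Q x) → count P? xs ℕ.+ count Q? xs ℕ.≤ length xs
  count-disjoint-length P? Q? xs d = ℕ.≤-trans
    (count-disjoint P? Q? U? xs d _ _) (length-filter U? xs)

  count-cong : {P Q : Pred A 0ℓ} (P? : Decidable P) (Q? : Decidable Q) → ∀ xs →
    (∀ {x} → x ∈ xs → P x → Q x) → (∀ {x} → x ∈ xs → Q x → P x) →
    count P? xs ≡ count Q? xs
  count-cong P? Q? xs f g = ℕ.≤-antisym (count-mono P? Q? xs f) (count-mono Q? P? xs g)

  module _ {P : Pred A 0ℓ} (P? : Decidable P) where

    count-complement : ∀ xs → count P? xs ℕ.+ count (¬? ∘ P?) xs ≡ length xs
    count-complement [] = refl
    count-complement (x ∷ xs) with P? x
    ... | yes _ = cong suc (count-complement xs)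
    ... | no  _ = trans (ℕ.+-suc _ _) (cong suc (count-complement xs))

    count-all : ∀ xs → (∀ {x} → x ∈ xs → P x) → count P? xs ≡ length xs
    count-all xs f = cong length (filter-all P? {xs} (All.tabulate f))

    count-none : ∀ xs → (∀ {x} → ¬ P x) → count P? xs ≡ 0
    count-none [] f = refl
    count-none (x ∷ xs) f with P? x
    ... | yes p = ⊥-elim (f p)
    ... | no _  = count-none xs f

    count-++ : ∀ xs ys → count P? (xs ++ ys) ≡ count P? xs ℕ.+ count P? ys
    count-++ xs ys = trans (cong length (filter-++ P? xs ys)) (length-++ (filter P? xs))

    count-concat-replicate : ∀ k xs → count P? (concat (replicate k xs)) ≡ k ℕ.* count P? xs
    count-concat-replicate zero    xs = refl
    count-concat-replicate (suc k) xs = trans (count-++ xs _)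
      (cong (count P? xs ℕ.+_) (count-concat-replicate k xs))

    count-filter : {Q : Pred A 0ℓ} (Q? : Decidable Q) → ∀ xs →
      count P? (filter Q? xs) ≡ count (λ x → P? x ×-dec Q? x) xs
    count-filter Q? [] = refl
    count-filter Q? (x ∷ xs) with Q? x | P? x in eq
    ... | no  _ | yes _ = count-filter Q? xs
    ... | no  _ | no  _ = count-filter Q? xs
    ... | yes _ | yes _ rewrite eq = cong suc (count-filter Q? xs)
    ... | yes _ | no  _ rewrite eq = count-filter Q? xs

length-concat-replicate : {A : Set} → ∀ k (xs : List A) →
  length (concat (replicate k xs)) ≡ k ℕ.* length xs
length-concat-replicate zero    xs = refl
length-concat-replicate (suc k) xs = trans (length-++ xs)
  (cong (length xs ℕ.+_) (length-concat-replicate k xs))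

∈-concat-replicate : ∀ {A : Set} {x : A} {xs} k → x ∈ concat (replicate k xs) → x ∈ xs
∈-concat-replicate {xs = xs} (suc k) x∈ = [ id , ∈-concat-replicate k ]′ (∈-++⁻ xs x∈)

module _ {A B : Set} (block : B → List A) where

  length-concatMap : ∀ {l} js → (∀ j → length (block j) ≡ l) →
    length (concatMap block js) ≡ length js ℕ.* l
  length-concatMap []       f = refl
  length-concatMap (j ∷ js) f =
    trans (length-++ (block j)) (cong₂ ℕ._+_ (f j) (length-concatMap js f))

  -- If every block with index in G has at least c entries in P, then the blocks
  -- together have at least c times as many as there are indices in G.
  count-concatMap-≥ : {P : Pred A 0ℓ} (P? : Decidable P) {G : Pred B 0ℓ} (G? : Decidable G) →
    ∀ {c} js → (∀ j → G j → c ℕ.≤ count P? (block j)) →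
    count G? js ℕ.* c ℕ.≤ count P? (concatMap block js)
  count-concatMap-≥ P? G? []       f = z≤n
  count-concatMap-≥ P? G? (j ∷ js) f
    rewrite count-++ P? (block j) (concatMap block js) with G? j
  ... | yes g = ℕ.+-mono-≤ (f j g) (count-concatMap-≥ P? G? js f)
  ... | no  _ = ℕ.≤-trans (count-concatMap-≥ P? G? js f) (ℕ.m≤n+m _ (count P? (block j)))

length-allFin : ∀ n → length (allFin n) ≡ n
length-allFin n = length-tabulate id

count-map : {A B : Set} {P : Pred B 0ℓ} (P? : Decidable P) (f : A → B) → ∀ xs →
  count P? (map f xs) ≡ count (P? ∘ f) xs
count-map P? f [] = refl
count-map P? f (x ∷ xs) with P? (f x)
... | yes _ = cong suc (count-map P? f xs)
... | no  _ = count-map P? f xs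

∣_∣≡count : ∀ {n} (S : Subset n) → ∣ S ∣ ≡ count (_∈? S) (allFin n)
∣ [] ∣≡count = refl
∣_∣≡count {suc n} (s ∷ S) = head-count s tail-count
  where
  tail-count : ∣ S ∣ ≡ count (_∈? (s ∷ S)) (List.tabulate suc)
  tail-count = trans ∣ S ∣≡count
    (trans (count-cong (_∈? S) ((_∈? (s ∷ S)) ∘ suc) (allFin n) (λ _ → there) (λ _ → drop-there))
    (trans (sym (count-map (_∈? (s ∷ S)) suc (allFin n)))
           (cong (count (_∈? (s ∷ S))) (map-tabulate id suc))))
  head-count : ∀ t → ∣ S ∣ ≡ count (_∈? (t ∷ S)) (List.tabulate suc) →
    ∣ t ∷ S ∣ ≡ count (_∈? (t ∷ S)) (allFin (suc n))
  head-count inside  eq = cong suc eq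
  head-count outside eq = eq

module _ {n} {P : Pred (Fin n) 0ℓ} (P? : Decidable P) where

  ∈-subset⁺ : ∀ {v} → P v → v Sub.∈ subset P?
  ∈-subset⁺ {v} p = lookup⇒[]= v _ (trans (lookup∘tabulate _ v) (dec-true (P? v) p))

  ∈-subset⁻ : ∀ {v} → v Sub.∈ subset P? → P v
  ∈-subset⁻ {v} v∈ with P? v | trans (sym (lookup∘tabulate (λ v → does (P? v)) v)) ([]=⇒lookup v∈)
  ... | yes p | _ = p
  ... | no  _ | ()

  ∣subset∣ : ∣ subset P? ∣ ≡ count P? (allFin n)
  ∣subset∣ = trans ∣ subset P? ∣≡count
    (count-cong (_∈? subset P?) P? (allFin n) (λ _ → ∈-subset⁻) (λ _ → ∈-subset⁺))

-- A set of vertices covered by the image of a list has at most as many elements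
-- as the list.
count-image : ∀ {A : Set} {n} {P : Pred (Fin n) 0ℓ} (P? : Decidable P) (g : A → Fin n) xs →
  (∀ {v} → P v → ∃[ x ] x ∈ xs × g x ≡ v) → count P? (allFin n) ℕ.≤ length xs
count-image {n = n} P? g [] f =
  ℕ.≤-reflexive (count-none P? (allFin n) (λ p → case f p of λ { (_ , () , _) }))
count-image {n = n} {P} P? g (x ∷ xs) f = ℕ.≤-trans
  (count-∪ (g x ≟F_) rest? P? (allFin n) split)
  (ℕ.+-mono-≤ single (count-image rest? g xs λ { (p , gx≢v) → shrink gx≢v (f p) }))
  where
  Rest : Pred (Fin n) 0ℓ
  Rest v = P v × g x ≢ v
  rest? : Decidable Rest
  rest? v = P? v ×-dec ¬? (g x ≟F v)
  split : ∀ {v} → P v → g x ≡ v ⊎ Rest v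
  split {v} p with g x ≟F v
  ... | yes eq = inj₁ eq
  ... | no neq = inj₂ (p , neq)
  shrink : ∀ {v} → g x ≢ v → ∃[ y ] y ∈ x ∷ xs × g y ≡ v → ∃[ y ] y ∈ xs × g y ≡ v
  shrink gx≢v (_ , here refl , eq) = ⊥-elim (gx≢v eq)
  shrink gx≢v (y , there y∈ , eq)  = y , y∈ , eq
  single : count (g x ≟F_) (allFin n) ℕ.≤ 1
  single = ℕ.≤-trans
    (count-mono (g x ≟F_) (_∈? ⁅ g x ⁆) (allFin n) (λ { _ refl → x∈⁅x⁆ (g x) }))
    (ℕ.≤-reflexive (trans (sym ∣ ⁅ g x ⁆ ∣≡count) (∣⁅x⁆∣≡1 (g x))))

count-subsingleton : ∀ {n} {P : Pred (Fin n) 0ℓ} (P? : Decidable P) →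
  (∀ {u v} → P u → P v → u ≡ v) → count P? (allFin n) ℕ.≤ 1
count-subsingleton P? unique with any? P?
... | yes (u , pu) = count-image P? id (u ∷ []) (λ pv → u , here refl , unique pu pv)
... | no none      = ℕ.≤-trans
  (ℕ.≤-reflexive (count-none P? (allFin _) (λ {v} pv → none (v , pv)))) z≤n

-- A subset that minimises f among those satisfying a satisfiable decidable
-- property.
argmin : ∀ {n} {P : Pred (Subset n) 0ℓ} → Decidable P → (f : Subset n → ℕ) →
  ∃ P → ∃[ S ] P S × (∀ T → P T → f S ℕ.≤ f T)
argmin {n} {P} P? f (S , p) = go S p (<-wellFounded (f S))
  where
  go : ∀ S → P S → Acc ℕ._<_ (f S) → ∃[ S ] P S × (∀ T → P T → f S ℕ.≤ f T)
  go S p (acc rs) with anySubset? (λ T → P? T ×-dec f T ℕ.<? f S)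
  ... | yes (T , q , T<S) = go T q (rs T<S)
  ... | no none = S , p , λ T q → ℕ.≮⇒≥ (λ T<S → none (T , q , T<S))

-- Quasi-kernels

-- Near R P is the closed in-neighbourhood of P for the relation R.  For the arcs
-- of a digraph, Near (Near P) consists of the vertices at distance at most 2
-- from P, since shortest walks are paths.
Near : {A : Set} → Rel A 0ℓ → Pred A 0ℓ → Pred A 0ℓ
Near _⟶_ P u = P u ⊎ ∃[ w ] u ⟶ w × P w

Near-map : {A B : Set} (R : Rel A 0ℓ) (S : Rel B 0ℓ) {P : Pred A 0ℓ} {Q : Pred B 0ℓ} (f : A → B) →
  (∀ {u w} → R u w → S (f u) (f w)) → (∀ {u} → P u → Q (f u)) →
  ∀ {u} → Near R P u → Near S Q (f u)
Near-map R S f r p (inj₁ u∈P)             = inj₁ (p u∈P)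
Near-map R S f r p (inj₂ (w , u⟶w , w∈P)) = inj₂ (f w , r u⟶w , p w∈P)

module _ (D : Digraph) where

  near? : {P : Pred (V D) 0ℓ} → Decidable P → Decidable (Near (Arc D) P)
  near? P? u = P? u ⊎-dec any? (λ w → arc? D u w ×-dec P? w)

  ¬sink⇒arc : ∀ {v} → ¬ Sink D v → ∃[ w ] Arc D v w
  ¬sink⇒arc {v} ¬sink with any? (arc? D v)
  ... | yes a = a
  ... | no ¬a = ⊥-elim (¬sink (λ w a → ¬a (w , a)))

  module _ {S : Subset (order D)} where

    dist≤1⇒near : ∀ {u} → DistToSet≤ D u S 1 → Near (Arc D) (Sub._∈ S) u
    dist≤1⇒near (v , v∈S , 0 , _ , x ∷ [] , refl , refl , _) = inj₁ v∈S
    dist≤1⇒near (v , v∈S , 1 , _ , x ∷ y ∷ [] , refl , refl , a ∷ _ , _) = inj₂ (v , a , v∈S)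
    dist≤1⇒near (v , v∈S , suc (suc _) , s≤s () , _)

    near⇒dist≤1 : ∀ {u} → Near (Arc D) (Sub._∈ S) u → DistToSet≤ D u S 1
    near⇒dist≤1 {u} (inj₁ u∈S) =
      u , u∈S , 0 , z≤n , u ∷ [] , refl , refl , [-] , [] ∷ []
    near⇒dist≤1 {u} (inj₂ (w , a , w∈S)) =
      w , w∈S , 1 , ℕ.≤-refl , u ∷ w ∷ [] , refl , refl , a ∷ [-]
      , ((λ u≡w → loopless D u≡w a) ∷ []) ∷ [] ∷ []

    dist≤2⇒near² : ∀ {u} → DistToSet≤ D u S 2 → Near (Arc D) (Near (Arc D) (Sub._∈ S)) u
    dist≤2⇒near² (v , v∈S , 0 , _ , x ∷ [] , refl , refl , _) = inj₁ (inj₁ v∈S)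
    dist≤2⇒near² (v , v∈S , 1 , _ , x ∷ y ∷ [] , refl , refl , a ∷ _ , _) =
      inj₁ (inj₂ (v , a , v∈S))
    dist≤2⇒near² (v , v∈S , 2 , _ , x ∷ y ∷ z ∷ [] , refl , refl , a ∷ b ∷ _ , _) =
      inj₂ (y , a , inj₂ (v , b , v∈S))
    dist≤2⇒near² (v , v∈S , suc (suc (suc _)) , s≤s (s≤s ()) , _)

    near²⇒dist≤2 : ∀ {u} → Near (Arc D) (Near (Arc D) (Sub._∈ S)) u → DistToSet≤ D u S 2
    near²⇒dist≤2 (inj₁ near) with v , v∈S , l , l≤1 , path ← near⇒dist≤1 near =
      v , v∈S , l , ℕ.≤-trans l≤1 (ℕ.n≤1+n 1) , path
    near²⇒dist≤2 (inj₂ (w , a , inj₁ w∈S)) = near²⇒dist≤2 (inj₁ (inj₂ (w , a , w∈S)))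
    near²⇒dist≤2 {u} (inj₂ (w , a , inj₂ (v , b , v∈S))) with u ≟F v
    ... | yes refl = near²⇒dist≤2 (inj₁ (inj₁ v∈S))
    ... | no u≢v =
      v , v∈S , 2 , ℕ.≤-refl , u ∷ w ∷ v ∷ [] , refl , refl , a ∷ b ∷ [-]
      , ((λ u≡w → loopless D u≡w a) ∷ u≢v ∷ [])
        ∷ ((λ w≡v → loopless D w≡v b) ∷ []) ∷ [] ∷ []

  -- Quasi-kernels as predicates on the vertices, with distances replaced by
  -- iterated closed in-neighbourhoods.
  record IsQuasiKernel (P : Pred (V D) 0ℓ) : Set where
    field
      independent : ∀ {u v} → P u → P v → ¬ Arc D u v
      absorbing   : ∀ u → Near (Arc D) (Near (Arc D) P) u

  open IsQuasiKernel public

  isQuasiKernel : ∀ {S} → QuasiKernel D S → IsQuasiKernel (Sub._∈ S)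
  independent (isQuasiKernel (ind , abs)) = ind
  absorbing   (isQuasiKernel (ind , abs)) u = dist≤2⇒near² (abs u)

  quasiKernel : ∀ {S} → IsQuasiKernel (Sub._∈ S) → QuasiKernel D S
  quasiKernel qk = independent qk , λ u → near²⇒dist≤2 (absorbing qk u)

  subset-quasiKernel : ∀ {P} (P? : Decidable P) → IsQuasiKernel P → QuasiKernel D (subset P?)
  subset-quasiKernel P? qk = quasiKernel record
    { independent = λ u∈ v∈ → independent qk (∈-subset⁻ P? u∈) (∈-subset⁻ P? v∈)
    ; absorbing   = λ u → Near-map (Arc D) (Arc D) id id
        (Near-map (Arc D) (Arc D) id id (∈-subset⁺ P?)) (absorbing qk u)
    }

  quasiKernel? : Decidable (QuasiKernel D)
  quasiKernel? S =
    map′ (λ h {u} {v} u∈S v∈S → h u v u∈S v∈S) (λ h u v u∈S v∈S → h u∈S v∈S)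
      (all? λ u → all? λ v → (u ∈? S) →-dec (v ∈? S) →-dec ¬? (arc? D u v))
    ×-dec all? (λ u → distToSet≤? D u S 2)

  ∣N⁻[_]∣ : ∀ S → ∣ N⁻[ D , S ] ∣ ≡ count (near? (_∈? S)) (allFin (order D))
  ∣N⁻[ S ]∣ = trans (∣subset∣ (λ u → distToSet≤? D u S 1))
    (count-cong _ (near? (_∈? S)) (allFin (order D)) (λ _ → dist≤1⇒near) (λ _ → near⇒dist≤1))

-- Digraphs given by a list of labels

-- The digraph whose vertices are the positions in the list xs, with arcs given by
-- a relation between the labels.  A repeated label gives twins: non-adjacent
-- vertices with the same neighbours.  Hence a list of vertices of D that
-- contains all of them gives a blow-up of D, and a list without repetitions an
-- induced subdigraph.
module Labelled {X : Set} (_≟_ : DecidableEquality X) (_⟶_ : Rel X 0ℓ)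
  (_⟶?_ : Decidable₂ _⟶_) (irrefl : Irreflexive _≡_ _⟶_) (xs : List X) where

  digraph : Digraph
  order    digraph = length xs
  Arc      digraph p q = lookup xs p ⟶ lookup xs q
  arc?     digraph p q = lookup xs p ⟶? lookup xs q
  loopless digraph p≡q = irrefl (cong (lookup xs) p≡q)

  -- Arcs whose head occurs in the list.
  _⟶ₓ_ : Rel X 0ℓ
  x ⟶ₓ y = y ∈ xs × x ⟶ y

  position : ∀ {x} → x ∈ xs → ∃[ p ] lookup xs p ≡ x
  position x∈xs = Any.index x∈xs , sym (lookup-index x∈xs)

  count-labels : {P : Pred X 0ℓ} (P? : Decidable P) →
    count (P? ∘ lookup xs) (allFin (length xs)) ≡ count P? xs
  count-labels P? = trans (sym (count-map P? (lookup xs) (allFin _)))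
    (cong (count P?) (trans (map-tabulate id (lookup xs)) (tabulate-lookup xs)))

  arc-image : ∀ {p q} → Arc digraph p q → lookup xs p ⟶ₓ lookup xs q
  arc-image {_} {q} a = ∈-lookup q , a

  module _ (Q : Subset (length xs)) where

    -- The labels of the vertices in Q.
    Image : Pred X 0ℓ
    Image x = ∃[ p ] p Sub.∈ Q × lookup xs p ≡ x

    image? : Decidable Image
    image? x = any? (λ p → (p ∈? Q) ×-dec (lookup xs p ≟ x))

    image∈ : ∀ {x} → Image x → x ∈ xs
    image∈ (p , _ , refl) = ∈-lookup p

    near-image : ∀ {p} → Near (Arc digraph) (Sub._∈ Q) p → Near _⟶ₓ_ Image (lookup xs p)
    near-image = Near-map (Arc digraph) _⟶ₓ_ (lookup xs) arc-image (λ {q} q∈Q → q , q∈Q , refl)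

    module _ (qk : QuasiKernel digraph Q) where

      image-independent : ∀ {x y} → Image x → Image y → ¬ (x ⟶ y)
      image-independent (p , p∈Q , refl) (q , q∈Q , refl) = proj₁ qk p∈Q q∈Q

      image-absorbing : ∀ {x} → x ∈ xs → Near _⟶ₓ_ (Near _⟶ₓ_ Image) x
      image-absorbing x∈xs with p , refl ← position x∈xs =
        Near-map (Arc digraph) _⟶ₓ_ (lookup xs) arc-image near-image
          (absorbing (isQuasiKernel digraph qk) p)

  sinkFree : (∀ {x} → x ∈ xs → ∃[ y ] x ⟶ₓ y) → SinkFree digraph
  sinkFree f p sink with y , y∈xs , a ← f (∈-lookup p)
    with q , refl ← position y∈xs = sink q a

-- From III to II

module Blowup (D : Digraph) (vs : List (V D)) where
  open Labelled _≟F_ (Arc D) (arc? D) (loopless D) vs public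

-- The blow-up of D given by a list of its vertices.  It is a genuine blow-up if
-- every vertex occurs.
blowup : (D : Digraph) → List (V D) → Digraph
blowup D vs = Blowup.digraph D vs

blowup-sinkFree : ∀ D vs → (∀ v → v ∈ vs) → SinkFree D → SinkFree (blowup D vs)
blowup-sinkFree D vs all sf = Blowup.sinkFree D vs λ {v} _ →
  let w , a = ¬sink⇒arc D (sf v) in w , all w , a

module _ (D : Digraph) where

  NonSinkSource : Pred (V D) 0ℓ
  NonSinkSource v = Source D v × ¬ Sink D v

  nonSinkSource? : Decidable NonSinkSource
  nonSinkSource? v = source? D v ×-dec ¬? (sink? D v)

  ∣nonSinkSources∣ : ∣ nonSinkSources D ∣ ≡ count nonSinkSource? (allFin (order D))
  ∣nonSinkSources∣ = ∣subset∣ nonSinkSource?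

  -- An out-neighbour of v; the value is v itself if v is a sink.
  outNeighbour : V D → V D
  outNeighbour v with any? (arc? D v)
  ... | yes (w , _) = w
  ... | no _        = v

  arc-outNeighbour : ∀ {v} → ¬ Sink D v → Arc D v (outNeighbour v)
  arc-outNeighbour {v} ¬sink with any? (arc? D v)
  ... | yes (w , a) = a
  ... | no ¬a       = ⊥-elim (¬sink (λ w a → ¬a (w , a)))

  -- Given a quasi-kernel P, discard its non-sink sources (Inner is what is left)
  -- and add the non-sink sources at distance more than 2 from Inner.  Sources
  -- have no in-neighbours, so this leaves all other vertices dominated and
  -- creates no arc.
  module SourceExchange {P : Pred (V D) 0ℓ} (P? : Decidable P) (qk : IsQuasiKernel D P) where

    Inner : Pred (V D) 0ℓ
    Inner v = P v × ¬ NonSinkSource v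

    inner? : Decidable Inner
    inner? v = P? v ×-dec ¬? (nonSinkSource? v)

    near²-inner? : Decidable (Near (Arc D) (Near (Arc D) Inner))
    near²-inner? = near? D (near? D inner?)

    Exchanged : Pred (V D) 0ℓ
    Exchanged v = Inner v ⊎ NonSinkSource v × ¬ Near (Arc D) (Near (Arc D) Inner) v

    exchanged? : Decidable Exchanged
    exchanged? v = inner? v ⊎-dec nonSinkSource? v ×-dec ¬? (near²-inner? v)

    head-inner : ∀ {v w} → Arc D v w → P w → Inner w
    head-inner {v} a p = p , λ s → proj₁ s v a

    near-inner : ∀ {v} → ¬ NonSinkSource v → Near (Arc D) P v → Near (Arc D) Inner v
    near-inner ¬s (inj₁ p)           = inj₁ (p , ¬s)
    near-inner ¬s (inj₂ (w , a , p)) = inj₂ (w , a , head-inner a p)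

    near-inner-head : ∀ {v w} → Arc D v w → Near (Arc D) P w → Near (Arc D) Inner w
    near-inner-head {v} a = near-inner (λ s → proj₁ s v a)

    exchanged-isQuasiKernel : IsQuasiKernel D Exchanged
    independent exchanged-isQuasiKernel (inj₁ (p , _)) (inj₁ (q , _)) = independent qk p q
    independent exchanged-isQuasiKernel (inj₂ (_ , far)) (inj₁ q) a = far (inj₁ (inj₂ (_ , a , q)))
    independent exchanged-isQuasiKernel _ (inj₂ ((src , _) , _)) a = src _ a
    absorbing exchanged-isQuasiKernel v with near²-inner? v | nonSinkSource? v
    ... | yes near | _     = Near-map (Arc D) (Arc D) id id (Near-map (Arc D) (Arc D) id id inj₁) near
    ... | no far   | yes s = inj₁ (inj₁ (inj₂ (s , far)))
    ... | no far   | no ¬s = ⊥-elim (far (near²-inner (absorbing qk v)))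
      where
      near²-inner : Near (Arc D) (Near (Arc D) P) v → Near (Arc D) (Near (Arc D) Inner) v
      near²-inner (inj₁ near)           = inj₁ (near-inner ¬s near)
      near²-inner (inj₂ (w , a , near)) = inj₂ (w , a , near-inner-head a near)

    -- The non-sink sources that are dominated through their chosen out-neighbour
    -- and hence not added.
    Saved : Pred (V D) 0ℓ
    Saved v = Near (Arc D) P (outNeighbour v) × NonSinkSource v

    saved? : Decidable Saved
    saved? v = near? D P? (outNeighbour v) ×-dec nonSinkSource? v

    exchanged⇒¬saved : ∀ {v} → Exchanged v → ¬ Saved v
    exchanged⇒¬saved (inj₁ (_ , ¬s)) (_ , s) = ¬s s
    exchanged⇒¬saved (inj₂ (_ , far)) (near , (_ , ¬sink)) =
      let a = arc-outNeighbour ¬sink in far (inj₂ (_ , a , near-inner-head a near))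

module _ {α : ℝ} (0<α : 0ℝ < α) (D : Digraph) where

  private
    n s : ℕ
    n = order D
    s = ∣ nonSinkSources D ∣

    sources : List (V D)
    sources = filter (nonSinkSource? D) (allFin n)

    -- Each vertex once, and k further copies of the chosen out-neighbour of every
    -- non-sink source.
    vs : ℕ → List (V D)
    vs k = allFin n ++ concat (replicate k (map (outNeighbour D) sources))

    length-vs : ∀ k → length (vs k) ≡ n ℕ.+ k ℕ.* s
    length-vs k = trans (length-++ (allFin n)) (cong₂ ℕ._+_ (length-allFin n)
      (trans (length-concat-replicate k (map (outNeighbour D) sources))
        (cong (k ℕ.*_) (trans (length-map (outNeighbour D) sources) (sym (∣nonSinkSources∣ D))))))

    vs-complete : ∀ k v → v ∈ vs k
    vs-complete k v = ∈-++⁺ˡ (∈-allFin v)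

    -- Here c counts the saved non-sink sources.
    quasiKernel-at : ∀ k → HasIII α (blowup D (vs k)) → ∃[ S ] QuasiKernel D S ×
      ∃[ c ] ∣ S ∣ ℕ.+ c ℕ.≤ n × 0 ⊕ k ℕ.* s · α ≼ n ℕ.+ k ℕ.* c
    quasiKernel-at k (Q , qk , large) =
      subset exchanged? , subset-quasiKernel D exchanged? exchanged-isQuasiKernel
      , count saved? (allFin n)
      , ℕ.≤-trans (ℕ.≤-reflexive (cong (ℕ._+ count saved? (allFin n)) (∣subset∣ exchanged?)))
          (ℕ.≤-trans (count-disjoint-length exchanged? saved? (allFin n) exchanged⇒¬saved)
            (ℕ.≤-reflexive (length-allFin n)))
      , ≼-mono 0<α z≤n (ℕ.≤-trans (ℕ.m≤n+m (k ℕ.* s) n) (ℕ.≤-reflexive (sym (length-vs k)))) bound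
          (III-bound⇒ large)
      where
      open Blowup D (vs k)
      image-isQuasiKernel : IsQuasiKernel D (Image Q)
      independent image-isQuasiKernel = image-independent Q qk
      absorbing image-isQuasiKernel v =
        Near-map _⟶ₓ_ (Arc D) id proj₂ (Near-map _⟶ₓ_ (Arc D) id proj₂ id)
          (image-absorbing Q qk (vs-complete k v))
      open SourceExchange D (image? Q) image-isQuasiKernel
      near-image? : Decidable (Near (Arc D) (Image Q))
      near-image? = near? D (image? Q)
      bound : ∣ N⁻[ digraph , Q ] ∣ ℕ.≤ n ℕ.+ k ℕ.* count saved? (allFin n)
      bound = begin
        ∣ N⁻[ digraph , Q ] ∣
          ≡⟨ ∣N⁻[_]∣ digraph Q ⟩
        count (near? digraph (_∈? Q)) (allFin (length (vs k)))
          ≤⟨ count-mono (near? digraph (_∈? Q)) (near-image? ∘ lookup (vs k)) (allFin (length (vs k)))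
               (λ _ → Near-map _⟶ₓ_ (Arc D) id proj₂ id ∘ near-image Q) ⟩
        count (near-image? ∘ lookup (vs k)) (allFin (length (vs k)))
          ≡⟨ count-labels near-image? ⟩
        count near-image? (vs k)
          ≡⟨ count-++ near-image? (allFin n) _ ⟩
        count near-image? (allFin n) ℕ.+
        count near-image? (concat (replicate k (map (outNeighbour D) sources)))
          ≤⟨ ℕ.+-mono-≤ (ℕ.≤-trans (length-filter near-image? (allFin n)) (ℕ.≤-reflexive (length-allFin n)))
               (ℕ.≤-reflexive (trans (count-concat-replicate near-image? k _)
                 (cong (k ℕ.*_) (trans (count-map near-image? (outNeighbour D) sources)
                   (count-filter (near-image? ∘ outNeighbour D) (nonSinkSource? D) (allFin n)))))) ⟩
        n ℕ.+ k ℕ.* count saved? (allFin n) ∎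
        where open ℕ.≤-Reasoning

  III-of-blowups⇒II : (∀ vs → (∀ v → v ∈ vs) → HasIII α (blowup D vs)) → HasII α D
  III-of-blowups⇒II III-blowup =
    let at k = quasiKernel-at k (III-blowup (vs k) (vs-complete k))
        S₀ , qk₀ , _ = at 0
        Q , qk , least = argmin (quasiKernel? D) ∣_∣ (S₀ , qk₀)
    in Q , qk , II-bound⇐ (≼-archimedean n λ k →
        let S , qkS , c , ∣S∣+c≤n , αks≤n+kc = at (suc k)
        in ≼-mono 0<α (ℕ.≤-reflexive (sym (ℕ.+-identityʳ _))) ℕ.≤-refl
             (count-bound (suc k) ∣ Q ∣ c (ℕ.≤-trans (ℕ.+-monoˡ-≤ c (least S qkS)) ∣S∣+c≤n))
             (≼-shift (suc k ℕ.* ∣ Q ∣) αks≤n+kc))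
    where
    count-bound : ∀ k q c → q ℕ.+ c ℕ.≤ n → k ℕ.* q ℕ.+ (n ℕ.+ k ℕ.* c) ℕ.≤ k ℕ.* n ℕ.+ n
    count-bound k q c h = begin
      k ℕ.* q ℕ.+ (n ℕ.+ k ℕ.* c)
        ≡⟨ solve 4 (λ k q n c → k :* q :+ (n :+ k :* c) := k :* (q :+ c) :+ n) refl k q n c ⟩
      k ℕ.* (q ℕ.+ c) ℕ.+ n
        ≤⟨ ℕ.+-monoˡ-≤ n (ℕ.*-monoʳ-≤ k h) ⟩
      k ℕ.* n ℕ.+ n ∎
      where
      open ℕ.≤-Reasoning
      open ℕ-Solver

-- From II to I

-- A quasi-kernel Q of least size in a sink-free digraph.  InNeighbour is the set
-- of in-neighbours of Q, Target the set of their chosen out-neighbours in Q,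
-- Spare the remainder of Q, and Rest the complement of InNeighbour and Target.
module Minimum (D : Digraph) (sf : SinkFree D) {Q : Subset (order D)} (qk : QuasiKernel D Q)
  (least : ∀ T → QuasiKernel D T → ∣ Q ∣ ℕ.≤ ∣ T ∣) where

  private
    n : ℕ
    n = order D
    kernel : IsQuasiKernel D (Sub._∈ Q)
    kernel = isQuasiKernel D qk

  InNeighbour : Pred (V D) 0ℓ
  InNeighbour v = ∃[ w ] Arc D v w × w Sub.∈ Q

  inNeighbour? : Decidable InNeighbour
  inNeighbour? v = any? (λ w → arc? D v w ×-dec (w ∈? Q))

  -- A chosen out-neighbour in Q of an in-neighbour of Q; the value at any other
  -- vertex is irrelevant.
  target : V D → V D
  target v with inNeighbour? v
  ... | yes (w , _) = w
  ... | no _        = v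

  target-arc : ∀ {v} → InNeighbour v → Arc D v (target v) × target v Sub.∈ Q
  target-arc {v} av with inNeighbour? v
  ... | yes (w , h) = h
  ... | no ¬av      = ⊥-elim (¬av av)

  Target Spare Rest : Pred (V D) 0ℓ
  Target q = ∃[ v ] InNeighbour v × target v ≡ q
  Spare q  = q Sub.∈ Q × ¬ Target q
  Rest v  = ¬ (InNeighbour v ⊎ Target v)

  target? : Decidable Target
  target? q = any? (λ v → inNeighbour? v ×-dec (target v ≟F q))

  spare? : Decidable Spare
  spare? q = (q ∈? Q) ×-dec ¬? (target? q)

  inNeighbour∪target? : Decidable (λ v → InNeighbour v ⊎ Target v)
  inNeighbour∪target? v = inNeighbour? v ⊎-dec target? v

  rest? : Decidable Rest
  rest? v = ¬? (inNeighbour∪target? v)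

  Target⊆Q : ∀ {q} → Target q → q Sub.∈ Q
  Target⊆Q (v , av , refl) = proj₂ (target-arc av)

  InNeighbour⇒∉Q : ∀ {v} → InNeighbour v → ¬ v Sub.∈ Q
  InNeighbour⇒∉Q (w , a , w∈Q) v∈Q = independent kernel v∈Q w∈Q a

  Spare⊆Rest : ∀ {q} → Spare q → Rest q
  Spare⊆Rest (q∈Q , _) (inj₁ aq) = InNeighbour⇒∉Q aq q∈Q
  Spare⊆Rest (_ , ¬t) (inj₂ t) = ¬t t

  -- If q were spare with an arc to the in-neighbour v, then q could be removed
  -- from Q: it is not the target of any vertex, and it reaches Q in two steps
  -- through v.
  spare-no-arc : ∀ {q v} → Spare q → InNeighbour v → ¬ Arc D q v
  spare-no-arc {q} {v} (q∈Q , ¬t) av a =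
    ℕ.<⇒≱ (x∈p⇒∣p-x∣<∣p∣ q∈Q) (least (Q Sub.- q) (quasiKernel D smaller))
    where
    target∈ : ∀ {u} → InNeighbour u → target u Sub.∈ Q Sub.- q
    target∈ {u} au = x∈p∧x≢y⇒x∈p-y (proj₂ (target-arc au)) (λ eq → ¬t (u , au , eq))
    near-inNeighbour : ∀ {u} → InNeighbour u → Near (Arc D) (Sub._∈ Q Sub.- q) u
    near-inNeighbour {u} au = inj₂ (target u , proj₁ (target-arc au) , target∈ au)
    near-Q : ∀ {u} → u Sub.∈ Q → Near (Arc D) (Near (Arc D) (Sub._∈ Q Sub.- q)) u
    near-Q {u} u∈Q with u ≟F q
    ... | yes refl = inj₂ (v , a , near-inNeighbour av)
    ... | no u≢q   = inj₁ (inj₁ (x∈p∧x≢y⇒x∈p-y u∈Q u≢q))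
    smaller : IsQuasiKernel D (Sub._∈ Q Sub.- q)
    independent smaller u∈ w∈ = independent kernel (p─q⊆p Q ⁅ q ⁆ u∈) (p─q⊆p Q ⁅ q ⁆ w∈)
    absorbing smaller u with absorbing kernel u
    ... | inj₁ (inj₁ u∈Q)         = near-Q u∈Q
    ... | inj₁ (inj₂ au)          = inj₁ (near-inNeighbour au)
    ... | inj₂ (w , b , inj₁ w∈Q) = inj₁ (near-inNeighbour (w , b , w∈Q))
    ... | inj₂ (w , b , inj₂ aw)  = inj₂ (w , b , near-inNeighbour aw)

  -- The subdigraph induced on Rest, in which the spare vertices are non-sink
  -- sources.
  rest : List (V D)
  rest = filter rest? (allFin n)

  open Labelled _≟F_ (Arc D) (arc? D) (loopless D) rest public

  Rest⇒∈rest : ∀ {v} → Rest v → v ∈ rest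
  Rest⇒∈rest {v} = ∈-filter⁺ rest? (∈-allFin v)

  ∈rest⇒Rest : ∀ {v} → v ∈ rest → Rest v
  ∈rest⇒Rest v∈rest = proj₂ (∈-filter⁻ rest? {xs = allFin n} v∈rest)

  spare⇒nonSinkSource : ∀ {p} → Spare (lookup rest p) → NonSinkSource digraph p
  proj₁ (spare⇒nonSinkSource {p} (q∈Q , _)) r a =
    ∈rest⇒Rest (∈-lookup r) (inj₁ (lookup rest p , a , q∈Q))
  proj₂ (spare⇒nonSinkSource {p} spare@(q∈Q , _)) sink with w , a ← ¬sink⇒arc D (sf (lookup rest p))
    with r , refl ← position (Rest⇒∈rest
           [ (λ aw → spare-no-arc spare aw a) , (λ tw → independent kernel q∈Q (Target⊆Q tw) a) ]′) =
    sink r a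

  ∣Spare∣≤sources : count spare? (allFin n) ℕ.≤ ∣ nonSinkSources digraph ∣
  ∣Spare∣≤sources = begin
    count spare? (allFin n)
      ≤⟨ count-mono spare? (λ v → spare? v ×-dec rest? v) (allFin n)
           (λ _ spare → spare , Spare⊆Rest spare) ⟩
    count (λ v → spare? v ×-dec rest? v) (allFin n)
      ≡⟨ count-filter spare? rest? (allFin n) ⟨
    count spare? rest
      ≡⟨ count-labels spare? ⟨
    count (spare? ∘ lookup rest) (allFin (length rest))
      ≤⟨ count-mono (spare? ∘ lookup rest) (nonSinkSource? digraph) (allFin (length rest))
           (λ _ → spare⇒nonSinkSource) ⟩
    count (nonSinkSource? digraph) (allFin (length rest))
      ≡⟨ ∣nonSinkSources∣ digraph ⟨
    ∣ nonSinkSources digraph ∣ ∎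
    where open ℕ.≤-Reasoning

  ∣Q∣≤∣Target∣+∣Spare∣ : ∣ Q ∣ ℕ.≤ count target? (allFin n) ℕ.+ count spare? (allFin n)
  ∣Q∣≤∣Target∣+∣Spare∣ = ℕ.≤-trans (ℕ.≤-reflexive ∣ Q ∣≡count)
    (count-∪ target? spare? (_∈? Q) (allFin n) split)
    where
    split : ∀ {q} → q Sub.∈ Q → Target q ⊎ Spare q
    split {q} q∈Q with target? q
    ... | yes t = inj₁ t
    ... | no ¬t = inj₂ (q∈Q , ¬t)

  ∣Target∣≤∣InNeighbour∣ : count target? (allFin n) ℕ.≤ count inNeighbour? (allFin n)
  ∣Target∣≤∣InNeighbour∣ = count-image target? target (filter inNeighbour? (allFin n))
    λ { (v , av , eq) → v , ∈-filter⁺ inNeighbour? (∈-allFin v) av , eq }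

  partition : count inNeighbour? (allFin n) ℕ.+ count target? (allFin n) ℕ.+ length rest ℕ.≤ n
  partition = begin
    count inNeighbour? (allFin n) ℕ.+ count target? (allFin n) ℕ.+ length rest
      ≤⟨ ℕ.+-monoˡ-≤ (length rest) (count-disjoint inNeighbour? target? inNeighbour∪target? (allFin n)
           (λ av tv → InNeighbour⇒∉Q av (Target⊆Q tv)) inj₁ inj₂) ⟩
    count inNeighbour∪target? (allFin n) ℕ.+ count rest? (allFin n)
      ≡⟨ trans (count-complement inNeighbour∪target? (allFin n)) (length-allFin n) ⟩
    n ∎
    where open ℕ.≤-Reasoning

  -- A quasi-kernel of D obtained from a quasi-kernel S of that subdigraph by adding
  -- the targets without an arc into S.
  module Replace {S : Subset (length rest)} (qkS : QuasiKernel digraph S) where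

    out? : Decidable (λ v → ∃[ w ] Arc D v w × Image S w)
    out? v = any? (λ w → arc? D v w ×-dec image? S w)

    Kept Replaced : Pred (V D) 0ℓ
    Kept v = Target v × ¬ (∃[ w ] Arc D v w × Image S w)
    Replaced v = Image S v ⊎ Kept v

    kept? : Decidable Kept
    kept? v = target? v ×-dec ¬? (out? v)

    replaced? : Decidable Replaced
    replaced? v = image? S v ⊎-dec kept? v

    near-target : ∀ {q} → Target q → Near (Arc D) Replaced q
    near-target {q} t with out? q
    ... | yes (w , a , i) = inj₂ (w , a , inj₁ i)
    ... | no ¬out         = inj₁ (inj₂ (t , ¬out))

    replaced-isQuasiKernel : IsQuasiKernel D Replaced
    independent replaced-isQuasiKernel (inj₁ i) (inj₁ j)        = image-independent S qkS i j
    independent replaced-isQuasiKernel (inj₁ i) (inj₂ (t , _)) a =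
      ∈rest⇒Rest (image∈ S i) (inj₁ (_ , a , Target⊆Q t))
    independent replaced-isQuasiKernel (inj₂ (_ , ¬out)) (inj₁ j) a = ¬out (_ , a , j)
    independent replaced-isQuasiKernel (inj₂ (q , _)) (inj₂ (r , _)) =
      independent kernel (Target⊆Q q) (Target⊆Q r)
    absorbing replaced-isQuasiKernel v with inNeighbour? v | target? v
    ... | yes av | _      = inj₂ (target v , proj₁ (target-arc av) , near-target (v , av , refl))
    ... | no _   | yes t = inj₁ (near-target t)
    ... | no ¬av | no ¬t =
      Near-map _⟶ₓ_ (Arc D) id proj₂ (Near-map _⟶ₓ_ (Arc D) id proj₂ inj₁)
        (image-absorbing S qkS (Rest⇒∈rest [ ¬av , ¬t ]′))

    ∣Q∣≤∣S∣+∣Target∣ : ∣ Q ∣ ℕ.≤ ∣ S ∣ ℕ.+ count target? (allFin n)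
    ∣Q∣≤∣S∣+∣Target∣ = begin
      ∣ Q ∣
        ≤⟨ least (subset replaced?) (subset-quasiKernel D replaced? replaced-isQuasiKernel) ⟩
      ∣ subset replaced? ∣
        ≡⟨ ∣subset∣ replaced? ⟩
      count replaced? (allFin n)
        ≤⟨ count-∪ (image? S) kept? replaced? (allFin n) id ⟩
      count (image? S) (allFin n) ℕ.+ count kept? (allFin n)
        ≤⟨ ℕ.+-mono-≤
             (count-image (image? S) (lookup rest) (filter (_∈? S) (allFin (length rest)))
               λ { (p , p∈S , eq) → p , ∈-filter⁺ (_∈? S) (∈-allFin p) p∈S , eq })
             (count-mono kept? target? (allFin n) (λ _ → proj₁)) ⟩
      count (_∈? S) (allFin (length rest)) ℕ.+ count target? (allFin n)
        ≡⟨ cong (ℕ._+ count target? (allFin n)) ∣ S ∣≡count ⟨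
      ∣ S ∣ ℕ.+ count target? (allFin n) ∎
      where open ℕ.≤-Reasoning

module _ {α : ℝ} (0<α : 0ℝ < α) (α≤½ : α ≤ ½ℝ) where

  II⇒I : II α → I (α / (1ℝ + α) ⟨ 0<1+ α 0<α ⟩)
  II⇒I II-α D sf =
    let S₀ , qk₀ , _ = II-α D
        Q , qk , least = argmin (quasiKernel? D) ∣_∣ (S₀ , qk₀)
        S , qkS , small = II-α (Minimum.digraph D sf qk least)
    in Q , qk , I-bound⇐ {α} 0<α {∣ Q ∣} {order D}
         (bound qk least qkS (II-bound⇒ {α} {∣ S ∣} small))
    where
    bound : ∀ {Q} (qk : QuasiKernel D Q) (least : ∀ T → QuasiKernel D T → ∣ Q ∣ ℕ.≤ ∣ T ∣) →
      let H = Minimum.digraph D sf qk least in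
      ∀ {S} → QuasiKernel H S → ∣ S ∣ ⊕ ∣ nonSinkSources H ∣ · α ≼ order H →
      ∣ Q ∣ ⊕ ∣ Q ∣ · α ≼ order D
    bound {Q} qk least {S} qkS small =
      ≼-mono 0<α
        (ℕ.≤-trans ∣Q∣≤∣S∣+∣Target∣ (ℕ.≤-reflexive
          (solve 2 (λ x y → x :+ y := (y :+ con 0) :+ x) refl ∣ S ∣ t)))
        (ℕ.≤-trans ∣Q∣≤∣Target∣+∣Spare∣ (ℕ.+-monoʳ-≤ t ∣Spare∣≤sources))
        size
        (≼-add (≼-shift t (≼-unit t α≤½)) small)
      where
      open Minimum D sf qk least
      open Replace qkS
      open ℕ-Solver
      t : ℕ
      t = count target? (allFin (order D))
      size : (t ℕ.+ t) ℕ.+ length rest ℕ.≤ order D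
      size = begin
        (t ℕ.+ t) ℕ.+ length rest
          ≤⟨ ℕ.+-monoˡ-≤ (length rest) (ℕ.+-monoˡ-≤ t ∣Target∣≤∣InNeighbour∣) ⟩
        (count inNeighbour? (allFin (order D)) ℕ.+ t) ℕ.+ length rest
          ≤⟨ partition ⟩
        order D ∎
        where open ℕ.≤-Reasoning

-- From sink-free II to III

-- The labels of the gadget: vertex v in the i-th copy of the vertices of D, a
-- pendant source at that vertex, and the i-th hub.
data Label (n m : ℕ) : Set where
  core pendant : Fin m → Fin n → Label n m
  hub          : Fin m → Label n m

module _ {n m : ℕ} where

  infix 4 _≟L_

  _≟L_ : DecidableEquality (Label n m)
  core i u    ≟L core j v    =
    map′ (λ { (refl , refl) → refl }) (λ { refl → refl , refl }) ((i ≟F j) ×-dec (u ≟F v))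
  core i u    ≟L pendant j v = no λ ()
  core i u    ≟L hub j       = no λ ()
  pendant i u ≟L core j v    = no λ ()
  pendant i u ≟L pendant j v =
    map′ (λ { (refl , refl) → refl }) (λ { refl → refl , refl }) ((i ≟F j) ×-dec (u ≟F v))
  pendant i u ≟L hub j       = no λ ()
  hub i       ≟L core j v    = no λ ()
  hub i       ≟L pendant j v = no λ ()
  hub i       ≟L hub j       = map′ (λ { refl → refl }) (λ { refl → refl }) (i ≟F j)

module _ (D : Digraph) where

  -- The vertices at distance at most 1 from a sink.
  NearSink : Pred (V D) 0ℓ
  NearSink = Near (Arc D) (Sink D)

  nearSink? : Decidable NearSink
  nearSink? = near? D (sink? D)

  -- The vertices whose copies get an arc to the hub.
  Exit : Pred (V D) 0ℓ
  Exit v = ∃[ w ] Arc D v w × NearSink w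

  exit? : Decidable Exit
  exit? v = any? (λ w → arc? D v w ×-dec nearSink? w)

  -- The vertices that are not near a sink.
  remaining : List (V D)
  remaining = filter (¬? ∘ nearSink?) (allFin (order D))

  -- The arcs between labels: those of D within each copy, from the vertices with an
  -- exit to the hub of their copy, from each pendant to its vertex, and between any
  -- two distinct hubs in both directions.
  data GadgetArc {m : ℕ} : Rel (Label (order D) m) 0ℓ where
    inner  : ∀ {i u v} → Arc D u v → GadgetArc (core i u) (core i v)
    exit   : ∀ {i u} → Exit u → GadgetArc (core i u) (hub i)
    attach : ∀ {i v} → GadgetArc (pendant i v) (core i v)
    link   : ∀ {i j} → i ≢ j → GadgetArc (hub i) (hub j)

  gadgetArc? : ∀ {m} → Decidable₂ (GadgetArc {m})
  gadgetArc? (core i u)    (core j v)    =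
    map′ (λ { (refl , a) → inner a }) (λ { (inner a) → refl , a }) ((i ≟F j) ×-dec arc? D u v)
  gadgetArc? (core i u)    (pendant j v) = no λ ()
  gadgetArc? (core i u)    (hub j)       =
    map′ (λ { (refl , e) → exit e }) (λ { (exit e) → refl , e }) ((i ≟F j) ×-dec exit? u)
  gadgetArc? (pendant i u) (core j v)    =
    map′ (λ { (refl , refl) → attach }) (λ { attach → refl , refl }) ((i ≟F j) ×-dec (u ≟F v))
  gadgetArc? (pendant i u) (pendant j v) = no λ ()
  gadgetArc? (pendant i u) (hub j)       = no λ ()
  gadgetArc? (hub i)       (core j v)    = no λ ()
  gadgetArc? (hub i)       (pendant j v) = no λ ()
  gadgetArc? (hub i)       (hub j)       =
    map′ link (λ { (link i≢j) → i≢j }) (¬? (i ≟F j))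

  gadgetArc-irrefl : ∀ {m} → Irreflexive _≡_ (GadgetArc {m})
  gadgetArc-irrefl refl (inner a)  = loopless D refl a
  gadgetArc-irrefl refl (link i≢i) = i≢i refl

-- The digraph made of m copies of the vertices that are not near a sink, each
-- with k pendant sources, and m hubs.
module Gadget (D : Digraph) (m k : ℕ) where

  private
    n r : ℕ
    n = order D
    r = length (remaining D)

  block : Fin m → List (Label n m)
  block i =
    map (core i) (remaining D) ++ concat (replicate k (map (pendant i) (remaining D))) ++ hub i ∷ []

  labels : List (Label n m)
  labels = concatMap block (allFin m)

  open Labelled _≟L_ (GadgetArc D) (gadgetArc? D) (gadgetArc-irrefl D) labels public

  ∈block⇒∈labels : ∀ {x} i → x ∈ block i → x ∈ labels
  ∈block⇒∈labels i x∈ = ∈-concatMap⁺ block (lose (∈-allFin i) x∈)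

  core∈labels : ∀ {i v} → ¬ NearSink D v → core i v ∈ labels
  core∈labels {i} {v} far = ∈block⇒∈labels i
    (∈-++⁺ˡ (∈-map⁺ (core i) (∈-filter⁺ (¬? ∘ nearSink? D) (∈-allFin v) far)))

  hub∈labels : ∀ {i} → hub i ∈ labels
  hub∈labels {i} = ∈block⇒∈labels i
    (∈-++⁺ʳ (map (core i) (remaining D)) (∈-++⁺ʳ (concat (replicate k _)) (here refl)))

  -- The vertex of a label, if any, is not near a sink; this holds for all labels in
  -- the list.
  Far : Pred (Label n m) 0ℓ
  Far (core i v)    = ¬ NearSink D v
  Far (pendant i v) = ¬ NearSink D v
  Far (hub i)       = ⊤

  remaining-far : ∀ {v} → v ∈ remaining D → ¬ NearSink D v
  remaining-far v∈ = proj₂ (∈-filter⁻ (¬? ∘ nearSink? D) {xs = allFin n} v∈)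

  labels-far : ∀ {x} → x ∈ labels → Far x
  labels-far x∈ with i , _ , x∈block ← find (∈-concatMap⁻ block {xs = allFin m} x∈)
    with ∈-++⁻ (map (core i) (remaining D)) x∈block
  ... | inj₁ x∈cores with v , v∈ , refl ← ∈-map⁻ (core i) x∈cores = remaining-far v∈
  ... | inj₂ x∈rest with ∈-++⁻ (concat (replicate k (map (pendant i) (remaining D)))) x∈rest
  ...   | inj₂ (here refl) = tt
  ...   | inj₁ x∈pendants
    with v , v∈ , refl ← ∈-map⁻ (pendant i) (∈-concat-replicate k x∈pendants) = remaining-far v∈

  length-labels : length labels ≡ m ℕ.* (r ℕ.+ (k ℕ.* r ℕ.+ 1))
  length-labels = trans (length-concatMap block (allFin m) length-block)
    (cong (ℕ._* (r ℕ.+ (k ℕ.* r ℕ.+ 1))) (length-allFin m))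
    where
    length-block : ∀ i → length (block i) ≡ r ℕ.+ (k ℕ.* r ℕ.+ 1)
    length-block i = trans (length-++ (map (core i) (remaining D)))
      (cong₂ ℕ._+_ (length-map (core i) (remaining D))
        (trans (length-++ (concat (replicate k (map (pendant i) (remaining D)))))
          (cong (ℕ._+ 1) (trans (length-concat-replicate k (map (pendant i) (remaining D)))
            (cong (k ℕ.*_) (length-map (pendant i) (remaining D)))))))

  count-pendants : ∀ {P : Pred (Label n m) 0ℓ} (P? : Decidable P) i →
    k ℕ.* count (P? ∘ pendant i) (remaining D) ℕ.≤ count P? (block i)
  count-pendants P? i = begin
    k ℕ.* count (P? ∘ pendant i) (remaining D)
      ≡⟨ cong (k ℕ.*_) (count-map P? (pendant i) (remaining D)) ⟨
    k ℕ.* count P? (map (pendant i) (remaining D))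
      ≡⟨ count-concat-replicate P? k (map (pendant i) (remaining D)) ⟨
    count P? pendants
      ≤⟨ ℕ.m≤m+n (count P? pendants) (count P? (hub i ∷ [])) ⟩
    count P? pendants ℕ.+ count P? (hub i ∷ [])
      ≡⟨ count-++ P? pendants (hub i ∷ []) ⟨
    count P? (pendants ++ hub i ∷ [])
      ≤⟨ ℕ.m≤n+m (count P? (pendants ++ hub i ∷ [])) (count P? (map (core i) (remaining D))) ⟩
    count P? (map (core i) (remaining D)) ℕ.+ count P? (pendants ++ hub i ∷ [])
      ≡⟨ count-++ P? (map (core i) (remaining D)) (pendants ++ hub i ∷ []) ⟨
    count P? (block i) ∎
    where
    open ℕ.≤-Reasoning
    pendants : List (Label n m)
    pendants = concat (replicate k (map (pendant i) (remaining D)))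

  Pendant : Pred (Label n m) 0ℓ
  Pendant (core _ _)    = ⊥
  Pendant (pendant _ _) = ⊤
  Pendant (hub _)       = ⊥

  pendant? : Decidable Pendant
  pendant? (core _ _)    = no id
  pendant? (pendant _ _) = yes tt
  pendant? (hub _)       = no id

  no-arc-to-pendant : ∀ {x y} → Pendant y → ¬ GadgetArc D x y
  no-arc-to-pendant () (inner _)
  no-arc-to-pendant () (exit _)
  no-arc-to-pendant () attach
  no-arc-to-pendant () (link _)

  pendant-head : ∀ {x y : Label n m} {i v} → x ≡ pendant i v → GadgetArc D x y → y ≡ core i v
  pendant-head refl attach = refl

  arc-from-pendant : ∀ {x} → x ∈ labels → Pendant x → ∃[ y ] x ⟶ₓ y
  arc-from-pendant {pendant i v} x∈ _ = core i v , core∈labels (labels-far x∈) , attach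

  pendant⇒nonSinkSource : ∀ {p} → Pendant (lookup labels p) → NonSinkSource digraph p
  proj₁ (pendant⇒nonSinkSource pend) q = no-arc-to-pendant pend
  proj₂ (pendant⇒nonSinkSource {p} pend) sink with y , y∈ , a ← arc-from-pendant (∈-lookup p) pend
    with q , refl ← position y∈ = sink q a

  sources-≥ : m ℕ.* (k ℕ.* r) ℕ.≤ ∣ nonSinkSources digraph ∣
  sources-≥ = begin
    m ℕ.* (k ℕ.* r)
      ≡⟨ cong (ℕ._* (k ℕ.* r)) (trans (count-all U? (allFin m) _) (length-allFin m)) ⟨
    count U? (allFin m) ℕ.* (k ℕ.* r)
      ≤⟨ count-concatMap-≥ block pendant? U? (allFin m) (λ i _ →
           ℕ.≤-trans
             (ℕ.≤-reflexive (cong (k ℕ.*_) (sym (count-all (pendant? ∘ pendant i) (remaining D) _))))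
             (count-pendants pendant? i)) ⟩
    count pendant? labels
      ≡⟨ count-labels pendant? ⟨
    count (pendant? ∘ lookup labels) (allFin (length labels))
      ≤⟨ count-mono (pendant? ∘ lookup labels) (nonSinkSource? digraph) (allFin (length labels))
           (λ _ → pendant⇒nonSinkSource) ⟩
    count (nonSinkSource? digraph) (allFin (length labels))
      ≡⟨ ∣nonSinkSources∣ digraph ⟨
    ∣ nonSinkSources digraph ∣ ∎
    where open ℕ.≤-Reasoning

  -- The quasi-kernels of D obtained from a quasi-kernel S of the gadget.  The i-th
  -- copy is bad if its hub is in S.
  module Copies {S : Subset (length labels)} (qk : QuasiKernel digraph S) where

    Bad Good : Pred (Fin m) 0ℓ
    Bad i  = Image S (hub i)
    Good i = ¬ Bad i

    bad? : Decidable Bad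
    bad? i = image? S (hub i)

    good? : Decidable Good
    good? i = ¬? (bad? i)

    bad-unique : ∀ {i j} → Bad i → Bad j → i ≡ j
    bad-unique {i} {j} bi bj with i ≟F j
    ... | yes i≡j = i≡j
    ... | no i≢j  = ⊥-elim (image-independent S qk bi bj (link i≢j))

    count-good : m ℕ.≤ suc (count good? (allFin m))
    count-good = begin
      m
        ≡⟨ trans (count-complement bad? (allFin m)) (length-allFin m) ⟨
      count bad? (allFin m) ℕ.+ count good? (allFin m)
        ≤⟨ ℕ.+-monoˡ-≤ (count good? (allFin m)) (count-subsingleton bad? bad-unique) ⟩
      suc (count good? (allFin m)) ∎
      where open ℕ.≤-Reasoning

    -- The trace of S on the i-th copy, together with the sinks of D.
    Restrict : Fin m → Pred (V D) 0ℓ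
    Restrict i v = Sink D v ⊎ Image S (core i v)

    restrict? : ∀ i → Decidable (Restrict i)
    restrict? i v = sink? D v ⊎-dec image? S (core i v)

    module _ {i} (good : Good i) where

      -- The hub of a good copy is not in S, so whatever S covers in the copy is
      -- covered by the trace.
      near-restrict : ∀ {v} → Near _⟶ₓ_ (Image S) (core i v) → Near (Arc D) (Restrict i) v
      near-restrict (inj₁ v∈)                       = inj₁ (inj₂ v∈)
      near-restrict (inj₂ (_ , (_ , inner a) , w∈)) = inj₂ (_ , a , inj₂ w∈)
      near-restrict (inj₂ (_ , (_ , exit _) , bad)) = ⊥-elim (good bad)

      nearSink⇒near : ∀ {v} → NearSink D v → Near (Arc D) (Restrict i) v
      nearSink⇒near = Near-map (Arc D) (Arc D) id id inj₁

      restrict-isQuasiKernel : IsQuasiKernel D (Restrict i)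
      independent restrict-isQuasiKernel (inj₁ sink) _        = sink _
      independent restrict-isQuasiKernel (inj₂ u∈) (inj₁ sink) a =
        labels-far (image∈ S u∈) (inj₂ (_ , a , sink))
      independent restrict-isQuasiKernel (inj₂ u∈) (inj₂ v∈) a = image-independent S qk u∈ v∈ (inner a)
      absorbing restrict-isQuasiKernel v with nearSink? D v | exit? D v
      ... | yes near | _                  = inj₁ (nearSink⇒near near)
      ... | no _     | yes (w , a , near) = inj₂ (w , a , nearSink⇒near near)
      ... | no far   | no ¬exit with image-absorbing S qk (core∈labels far)
      ...   | inj₁ near                        = inj₁ (near-restrict near)
      ...   | inj₂ (_ , (_ , inner a) , near) = inj₂ (_ , a , near-restrict near)
      ...   | inj₂ (_ , (_ , exit e) , _)     = ⊥-elim (¬exit e)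

      -- Every out-neighbour of the pendant at v is labelled by the copy of v.  If the
      -- trace of S does not cover v, then S contains neither such a vertex nor an
      -- out-neighbour of one, so the pendant is within distance 2 of S only if it
      -- belongs to S.
      uncovered-pendant : ∀ {v p} →
        ¬ Near (Arc D) (Restrict i) v → lookup labels p ≡ pendant i v → p Sub.∈ S
      uncovered-pendant {v} {p} ¬near eq with absorbing (isQuasiKernel digraph qk) p
      ... | inj₁ (inj₁ p∈S)           = p∈S
      ... | inj₁ (inj₂ (q , a , q∈S)) =
        ⊥-elim (¬near (near-restrict (inj₁ (q , q∈S , pendant-head eq a))))
      ... | inj₂ (q , a , near)       =
        ⊥-elim (¬near (near-restrict (subst (Near _⟶ₓ_ (Image S)) (pendant-head eq a) (near-image S near))))

    quasiKernel-of : ∀ i → Good i → ∃ (QuasiKernel D)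
    quasiKernel-of i good =
      subset (restrict? i) , subset-quasiKernel D (restrict? i) (restrict-isQuasiKernel good)

    -- The pendants of the uncovered vertices of good copies; they all lie in S.
    Uncovered : Pred (Label n m) 0ℓ
    Uncovered (core _ _)    = ⊥
    Uncovered (pendant i v) = Good i × ¬ Near (Arc D) (Restrict i) v
    Uncovered (hub _)       = ⊥

    uncovered? : Decidable Uncovered
    uncovered? (core _ _)    = no id
    uncovered? (pendant i v) = good? i ×-dec ¬? (near? D (restrict? i) v)
    uncovered? (hub _)       = no id

    uncovered⇒∈ : ∀ {p x} → lookup labels p ≡ x → Uncovered x → p Sub.∈ S
    uncovered⇒∈ {x = pendant i v} eq (good , ¬near) = uncovered-pendant good ¬near eq

    -- c bounds from below the number of uncovered vertices in each good copy.
    -- Vertices near a sink are always covered, so the uncovered ones all have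
    -- pendants.
    size-≥ : ∀ {c} →
      (∀ i → Good i → c ℕ.≤ count (¬? ∘ near? D (restrict? i)) (allFin n)) →
      count good? (allFin m) ℕ.* (k ℕ.* c) ℕ.≤ ∣ S ∣
    size-≥ {c} c≤ = begin
      count good? (allFin m) ℕ.* (k ℕ.* c)
        ≤⟨ count-concatMap-≥ block uncovered? good? (allFin m) (λ i good →
             ℕ.≤-trans (ℕ.*-monoʳ-≤ k (ℕ.≤-trans (c≤ i good) (in-remaining i good)))
               (count-pendants uncovered? i)) ⟩
      count uncovered? labels
        ≡⟨ count-labels uncovered? ⟨
      count (uncovered? ∘ lookup labels) (allFin (length labels))
        ≤⟨ count-mono (uncovered? ∘ lookup labels) (_∈? S) (allFin (length labels))
             (λ _ → uncovered⇒∈ refl) ⟩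
      count (_∈? S) (allFin (length labels))
        ≡⟨ ∣ S ∣≡count ⟨
      ∣ S ∣ ∎
      where
      open ℕ.≤-Reasoning
      in-remaining : ∀ i → Good i →
        count (¬? ∘ near? D (restrict? i)) (allFin n) ℕ.≤ count (uncovered? ∘ pendant i) (remaining D)
      in-remaining i good = ℕ.≤-trans
        (count-mono (¬? ∘ near? D (restrict? i))
          (λ v → uncovered? (pendant i v) ×-dec ¬? (nearSink? D v)) (allFin n)
          (λ _ ¬near → (good , ¬near) , ¬near ∘ nearSink⇒near good))
        (ℕ.≤-reflexive (sym (count-filter (uncovered? ∘ pendant i) (¬? ∘ nearSink? D) (allFin n))))

gadget-sinkFree : ∀ D m k → SinkFree (Gadget.digraph D (suc (suc m)) k)
gadget-sinkFree D m k = sinkFree out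
  where
  open Gadget D (suc (suc m)) k
  other : (i : Fin (suc (suc m))) → ∃[ j ] i ≢ j
  other zero    = suc zero , λ ()
  other (suc i) = zero , λ ()
  out : ∀ {x} → x ∈ labels → ∃[ y ] x ⟶ₓ y
  out {pendant i v} x∈ = arc-from-pendant x∈ tt
  out {hub i} _ = let j , i≢j = other i in hub j , hub∈labels , link i≢j
  out {core i v} x∈ with w , a ← ¬sink⇒arc D (λ sink → labels-far x∈ (inj₁ sink)) with nearSink? D w
  ... | yes near = hub i , hub∈labels , exit (w , a , near)
  ... | no far   = core i w , core∈labels far , inner a

module _ {α : ℝ} (0<α : 0ℝ < α) (α≤½ : α ≤ ½ℝ) (II-sf : IIˢᶠ α) (D : Digraph) where

  private
    n r u : ℕ
    n = order D
    r = length (remaining D)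
    u = count (nearSink? D) (allFin n)

    u+r≡n : u ℕ.+ r ≡ n
    u+r≡n = trans (count-complement (nearSink? D) (allFin n)) (length-allFin n)

    -- The number of vertices outside the closed in-neighbourhood of S.
    missed : Subset n → ℕ
    missed S = count (¬? ∘ near? D (_∈? S)) (allFin n)

    -- Of two copies at least one is good.
    some-quasiKernel : ∃ (QuasiKernel D)
    some-quasiKernel = let _ , qk , _ = II-sf digraph (gadget-sinkFree D 0 0) in find-good qk
      where
      open Gadget D 2 0
      find-good : ∀ {S} → QuasiKernel digraph S → ∃ (QuasiKernel D)
      find-good {S} qk with image? S (hub zero)
      ... | no good = quasiKernel-of zero good
        where open Copies qk
      ... | yes bad = quasiKernel-of (suc zero) (λ bad′ → case bad-unique bad bad′ of λ ())
        where open Copies qk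

    module _ {c : ℕ} (c≤ : ∀ T → QuasiKernel D T → c ℕ.≤ missed T) where

      size-bound : ∀ m k {S} → QuasiKernel (Gadget.digraph D (suc m) k) S →
        m ℕ.* (k ℕ.* c) ℕ.≤ ∣ S ∣
      size-bound m k {S} qk = ℕ.≤-trans (ℕ.*-monoˡ-≤ (k ℕ.* c) (ℕ.s≤s⁻¹ count-good)) (size-≥ c≤′)
        where
        open Gadget D (suc m) k
        open Copies qk
        c≤′ : ∀ i → Good i → c ℕ.≤ count (¬? ∘ near? D (restrict? i)) (allFin n)
        c≤′ i good = ℕ.≤-trans
          (c≤ (subset (restrict? i)) (proj₂ (quasiKernel-of i good)))
          (count-mono (¬? ∘ near? D (_∈? subset (restrict? i))) (¬? ∘ near? D (restrict? i)) (allFin n)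
            (λ _ ¬near → ¬near ∘ Near-map (Arc D) (Arc D) id id (∈-subset⁺ (restrict? i))))

      gadget-bound : ∀ k → suc k ℕ.* (suc k ℕ.* c) ⊕ suc (suc k) ℕ.* (suc k ℕ.* r) · α ≼
        suc (suc k) ℕ.* (r ℕ.+ (suc k ℕ.* r ℕ.+ 1))
      gadget-bound k =
        let S , qk , small = II-sf digraph (gadget-sinkFree D k (suc k))
        in ≼-mono 0<α (size-bound (suc k) (suc k) qk) sources-≥ (ℕ.≤-reflexive length-labels)
             (II-bound⇒ {α} {∣ S ∣} {order digraph} {∣ nonSinkSources digraph ∣} small)
        where open Gadget D (suc (suc k)) (suc k)

      -- With K = k + 1 pendants and K + 1 copies the bound of IIˢᶠ reads
      -- K²c + α(K + 1)Kr ≤ (K + 1)(r + Kr + 1), where r + u = n; adding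
      -- α(K + 1)Ku ≤ (K + 1)Ku and dividing by K leaves a bounded error.
      missed-bound : ∀ k → suc k ℕ.* c ⊕ suc k ℕ.* n · α ≼ suc k ℕ.* n ℕ.+ (n ℕ.+ (r ℕ.+ r ℕ.+ 2))
      missed-bound k = ≼-unscale k (copies-arithmetic (suc k) (s≤s z≤n) (gadget-bound k))
        where
        copies-arithmetic : ∀ K → 1 ℕ.≤ K →
          K ℕ.* (K ℕ.* c) ⊕ suc K ℕ.* (K ℕ.* r) · α ≼ suc K ℕ.* (r ℕ.+ (K ℕ.* r ℕ.+ 1)) →
          K ℕ.* (K ℕ.* c) ⊕ K ℕ.* (K ℕ.* n) · α ≼ K ℕ.* (K ℕ.* n ℕ.+ (n ℕ.+ (r ℕ.+ r ℕ.+ 2)))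
        copies-arithmetic K 1≤K h =
          ≼-mono 0<α (ℕ.m≤m+n (K ℕ.* (K ℕ.* c)) 0) lower upper (≼-add h (≼-unit (suc K ℕ.* (K ℕ.* u)) α≤½))
          where
          open ℕ.≤-Reasoning
          open ℕ-Solver
          lower : K ℕ.* (K ℕ.* n) ℕ.≤ suc K ℕ.* (K ℕ.* r) ℕ.+ suc K ℕ.* (K ℕ.* u)
          lower = begin
            K ℕ.* (K ℕ.* n)
              ≤⟨ ℕ.*-monoˡ-≤ (K ℕ.* n) (ℕ.n≤1+n K) ⟩
            suc K ℕ.* (K ℕ.* n)
              ≡⟨ cong (λ x → suc K ℕ.* (K ℕ.* x)) u+r≡n ⟨
            suc K ℕ.* (K ℕ.* (u ℕ.+ r))
              ≡⟨ solve 4 (λ m k r u → m :* (k :* (u :+ r)) := m :* (k :* r) :+ m :* (k :* u))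
                   refl (suc K) K r u ⟩
            suc K ℕ.* (K ℕ.* r) ℕ.+ suc K ℕ.* (K ℕ.* u) ∎
          upper : suc K ℕ.* (r ℕ.+ (K ℕ.* r ℕ.+ 1)) ℕ.+ suc K ℕ.* (K ℕ.* u) ℕ.≤
            K ℕ.* (K ℕ.* n ℕ.+ (n ℕ.+ (r ℕ.+ r ℕ.+ 2)))
          upper = begin
            suc K ℕ.* (r ℕ.+ (K ℕ.* r ℕ.+ 1)) ℕ.+ suc K ℕ.* (K ℕ.* u)
              ≡⟨ solve 4 (λ m k r u → m :* (r :+ (k :* r :+ con 1)) :+ m :* (k :* u)
                                   := m :* (k :* (u :+ r)) :+ m :* (r :+ con 1))
                   refl (suc K) K r u ⟩
            suc K ℕ.* (K ℕ.* (u ℕ.+ r)) ℕ.+ suc K ℕ.* (r ℕ.+ 1)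
              ≡⟨ cong (λ x → suc K ℕ.* (K ℕ.* x) ℕ.+ suc K ℕ.* (r ℕ.+ 1)) u+r≡n ⟩
            suc K ℕ.* (K ℕ.* n) ℕ.+ suc K ℕ.* (r ℕ.+ 1)
              ≤⟨ ℕ.+-monoʳ-≤ (suc K ℕ.* (K ℕ.* n)) (ℕ.*-monoˡ-≤ (r ℕ.+ 1) (ℕ.+-monoˡ-≤ K 1≤K)) ⟩
            suc K ℕ.* (K ℕ.* n) ℕ.+ (K ℕ.+ K) ℕ.* (r ℕ.+ 1)
              ≡⟨ solve 3 (λ k n r → (con 1 :+ k) :* (k :* n) :+ (k :+ k) :* (r :+ con 1)
                                 := k :* (k :* n :+ (n :+ (r :+ r :+ con 2))))
                   refl K n r ⟩
            K ℕ.* (K ℕ.* n ℕ.+ (n ℕ.+ (r ℕ.+ r ℕ.+ 2))) ∎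

  IIˢᶠ⇒HasIII : HasIII α D
  IIˢᶠ⇒HasIII =
    let Q , qk , least = argmin (quasiKernel? D) missed some-quasiKernel
    in Q , qk , III-bound⇐ {α} {n} {∣ N⁻[ D , Q ] ∣} (≼-cancel (missed Q)
         (≼-mono 0<α ℕ.≤-refl ℕ.≤-refl (covered Q)
           (≼-archimedean (n ℕ.+ (r ℕ.+ r ℕ.+ 2)) (missed-bound least))))
    where
    covered : ∀ Q → n ℕ.≤ ∣ N⁻[ D , Q ] ∣ ℕ.+ missed Q
    covered Q = ℕ.≤-reflexive (sym (trans
      (cong (ℕ._+ missed Q) (∣N⁻[_]∣ D Q))
      (trans (count-complement (near? D (_∈? Q)) (allFin n)) (length-allFin n))))

proposition1p4 : (α : ℝ) (0<α : 0ℝ < α) → α ≤ ½ℝ →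
    ((II α ⇔ III α) × (II α ⇔ IIˢᶠ α) × (III α ⇔ IIIˢᶠ α))
    × (I α → III α)
    × (III α → I (α / (1ℝ + α) ⟨ 0<1+ α 0<α ⟩))
proposition1p4 α 0<α α≤½ =
  ( mk⇔ (IIsf⇒III ∘ II⇒IIsf) III⇒II
  , mk⇔ II⇒IIsf (III⇒II ∘ IIsf⇒III)
  , mk⇔ III⇒IIIsf (IIsf⇒III ∘ IIIsf⇒IIsf))
  , IIsf⇒III ∘ I⇒IIsf
  , II⇒I {α} 0<α α≤½ ∘ III⇒II
  where
  II⇒IIsf : II α → IIˢᶠ α
  II⇒IIsf h D _ = h D
  III⇒IIIsf : III α → IIIˢᶠ α
  III⇒IIIsf h D _ = h D
  IIsf⇒III : IIˢᶠ α → III α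
  IIsf⇒III h = IIˢᶠ⇒HasIII {α} 0<α α≤½ h
  III⇒II : III α → II α
  III⇒II h D = III-of-blowups⇒II {α} 0<α D (λ vs _ → h (blowup D vs))
  IIIsf⇒IIsf : IIIˢᶠ α → IIˢᶠ α
  IIIsf⇒IIsf h D sf = III-of-blowups⇒II {α} 0<α D
    (λ vs complete → h (blowup D vs) (blowup-sinkFree D vs complete sf))
  I⇒IIsf : I α → IIˢᶠ α
  I⇒IIsf h D sf =
    let Q , qk , small = h D sf
    in Q , qk , II-bound⇐ {α} {∣ Q ∣} {order D}
         (≼-mono 0<α ℕ.≤-refl s≤n ℕ.≤-refl (I-bound⇒ {α} {∣ Q ∣} {order D} small))
    where
    s≤n : ∣ nonSinkSources D ∣ ℕ.≤ order D
    s≤n = ∣p∣≤n (nonSinkSources D)
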